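{- Let $n\ge 1$, let $\mu$ be a partition with at most $n$ parts (regarded as a weak composition with $n$ parts by appending zeros), and let $\alpha$ be a weak composition with $n$ parts. Then the product of Demazure atoms $\mathcal{A}_\mu\cdot\mathcal{A}_\alpha$ is atom-positive, i.e. there are nonnegative integers $c_\beta$ such that $\mathcal{A}_\mu\cdot\mathcal{A}_\alpha=\sum_{\beta}c_\beta\,\mathcal{A}_\beta$, the sum running over weak compositions $\beta$.
   Context: Let $P=\mathbb{Z}[x_1,x_2,\dots]$. For $i\ge1$ let $s_i$ act on $P$ by swapping $x_i$ and $x_{i+1}$, and define operators $\partial_i f=\frac{f-s_if}{x_i-x_{i+1}}$ and $\theta_i f=x_{i+1}\partial_i f$. For a permutation $w$ with reduced decomposition $w=s_{i_1}\cdots s_{i_l}$ put $\theta_w=\theta_{i_1}\cdots\theta_{i_l}$ (composition of operators; independent of the reduced word), with $\theta_{\mathrm{id}}$ the identity. For a weak composition $\gamma=(\gamma_1,\dots,\gamma_n)$ write $x^\gamma=x_1^{\gamma_1}\cdots x_n^{\gamma_n}$; $s_i$ acts on weak compositions by swapping the $i$-th and $(i+1)$-th entries. Let $\lambda$ be the partition obtained by sorting $\gamma$ into weakly decreasing order and let $w$ be the permutation of minimal length with $w\cdot\lambda=\gamma$ (where $s_{i_1}\cdots s_{i_l}\cdot\lambda$ means apply $s_{i_l}$ first). The Demazure atom is $\mathcal{A}_\gamma=\theta_w x^\lambda$. (For a partition $\mu$, $\mathcal{A}_\mu=x^\mu$.) The atoms form a basis of $P$ (over weak compositions of all lengths). 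-}

module Defs where

open import Algebra.Bundles using (CommutativeRing)
import Algebra.Properties.Semiring.Exp as Exp
import Algebra.Properties.Ring as RingProperties
import Algebra.Solver.Ring
open import Algebra.Solver.Ring.AlmostCommutativeRing
  using (fromCommutativeRing; _-Raw-AlmostCommutative⟶_)
open import Data.Fin.Base using (Fin; zero; suc; toℕ)
import Data.Fin.Properties as Fin
open import Data.Fin.Permutation as Perm
  using (Permutation′; _⟨$⟩ʳ_; _⟨$⟩ˡ_; _∘ₚ_; transpose)
open import Data.Integer.Base as ℤ using (ℤ; +_)
import Data.Integer.Properties as ℤ
open import Data.List.Base as List using (List; []; _∷_; _++_; foldr; length)
import Data.List.Properties as List
open import Data.Maybe.Base using (just; nothing)
open import Data.Nat.Base as ℕ using (ℕ; zero; suc; _≤_; _≥_; s≤s)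
import Data.Nat.Properties as ℕ
open import Data.Product.Base using (Σ-syntax; ∃; _×_; _,_)
open import Data.Vec.Base using (Vec; []; _∷_; lookup; tabulate)
import Data.Vec.Properties as Vec
open import Data.Vec.Relation.Unary.Linked using (Linked; []; [-]; _∷_)
open import Level using (0ℓ)
open import Relation.Binary.Definitions using (WeaklyDecidable)
open import Relation.Binary.PropositionalEquality as ≡
  using (_≡_; cong; cong₂)
open import Relation.Nullary using (yes; no; contradiction)

private
  variable
    n : ℕ

infixl 6 _+_
infixl 7 _*_
infix  8 -_
infix  4 _≈_

-- ℤ[x₁, x₂, …] as the free commutative ring on countably many generators:
-- ring terms modulo the congruence _≈_ generated by the commutative ring
-- axioms and the requirement that con be a ring homomorphism.
-- Indices are 0-based: x k is x_{k+1}, and likewise s k, ∂ k, θ k below.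

data P : Set where
  con : ℤ → P
  x   : ℕ → P
  _+_ : P → P → P
  _*_ : P → P → P
  -_  : P → P

data _≈_ : P → P → Set where
  ≈-refl  : ∀ {f} → f ≈ f
  ≈-sym   : ∀ {f g} → f ≈ g → g ≈ f
  ≈-trans : ∀ {f g h} → f ≈ g → g ≈ h → f ≈ h

  +-cong : ∀ {f f′ g g′} → f ≈ f′ → g ≈ g′ → f + g ≈ f′ + g′
  *-cong : ∀ {f f′ g g′} → f ≈ f′ → g ≈ g′ → f * g ≈ f′ * g′
  neg-cong : ∀ {f f′} → f ≈ f′ → - f ≈ - f′

  +-assoc     : ∀ f g h → (f + g) + h ≈ f + (g + h)
  +-comm      : ∀ f g → f + g ≈ g + f
  +-identityʳ : ∀ f → f + con (+ 0) ≈ f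
  +-inverseʳ  : ∀ f → f + (- f) ≈ con (+ 0)
  *-assoc     : ∀ f g h → (f * g) * h ≈ f * (g * h)
  *-comm      : ∀ f g → f * g ≈ g * f
  *-identityʳ : ∀ f → f * con (+ 1) ≈ f
  *-distribˡ  : ∀ f g h → f * (g + h) ≈ f * g + f * h

  con-+ : ∀ a b → con (a ℤ.+ b) ≈ con a + con b
  con-* : ∀ a b → con (a ℤ.* b) ≈ con a * con b

P-commutativeRing : CommutativeRing 0ℓ 0ℓ
P-commutativeRing = record
  { Carrier = P
  ; _≈_ = _≈_
  ; _+_ = _+_
  ; _*_ = _*_
  ; -_  = -_
  ; 0#  = con (+ 0)
  ; 1#  = con (+ 1)
  ; isCommutativeRing = record
    { isRing = record
      { +-isAbelianGroup = record
        { isGroup = record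
          { isMonoid = record
            { isSemigroup = record
              { isMagma = record
                { isEquivalence = record
                  { refl = ≈-refl ; sym = ≈-sym ; trans = ≈-trans }
                ; ∙-cong = +-cong
                }
              ; assoc = +-assoc
              }
            ; identity = (λ f → ≈-trans (+-comm _ f) (+-identityʳ f)) , +-identityʳ
            }
          ; inverse = (λ f → ≈-trans (+-comm _ f) (+-inverseʳ f)) , +-inverseʳ
          ; ⁻¹-cong = neg-cong
          }
        ; comm = +-comm
        }
      ; *-cong = *-cong
      ; *-assoc = *-assoc
      ; *-identity = (λ f → ≈-trans (*-comm _ f) (*-identityʳ f)) , *-identityʳ
      ; distrib = *-distribˡ , λ f g h →
          ≈-trans (*-comm _ f) (≈-trans (*-distribˡ f g h)
            (+-cong (*-comm f g) (*-comm f h)))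
      }
    ; *-comm = *-comm
    }
  }

open CommutativeRing P-commutativeRing public
  using (0#; 1#; _-_; setoid)
open Exp (CommutativeRing.semiring P-commutativeRing) public
  using (_^_)

con-neg : ∀ a → con (ℤ.- a) ≈ - con a
con-neg a = RingProperties.+-inverseʳ-unique (CommutativeRing.ring P-commutativeRing)
  (con a) (con (ℤ.- a))
  (≈-trans (≈-sym (con-+ a (ℤ.- a)))
    (≡.subst (λ b → con b ≈ con (+ 0)) (≡.sym (ℤ.+-inverseʳ a)) ≈-refl))

private
  con-homomorphism :
    CommutativeRing.rawRing ℤ.+-*-commutativeRing
      -Raw-AlmostCommutative⟶ fromCommutativeRing P-commutativeRing
  con-homomorphism = record
    { ⟦_⟧ = con
    ; +-homo = con-+
    ; *-homo = con-*
    ; -‿homo = con-neg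
    ; 0-homo = ≈-refl
    ; 1-homo = ≈-refl
    }

  con-≟ : WeaklyDecidable (λ a b → con a ≈ con b)
  con-≟ a b with a ℤ.≟ b
  ... | yes ≡.refl = just ≈-refl
  ... | no  _      = nothing

module P-Solver = Algebra.Solver.Ring
  (CommutativeRing.rawRing ℤ.+-*-commutativeRing)
  (fromCommutativeRing P-commutativeRing) con-homomorphism con-≟

-- x₁^γ₁ ⋯ xₙ^γₙ is monomial 0 γ; the first argument shifts the variables.

monomial : ℕ → Vec ℕ n → P
monomial k []      = 1#
monomial k (a ∷ γ) = x k ^ a * monomial (suc k) γ

x^_ : Vec ℕ n → P
x^ γ = monomial 0 γ

swap : ℕ → ℕ → ℕ
swap zero    zero          = 1
swap zero    (suc zero)    = 0
swap zero    (suc (suc j)) = suc (suc j)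
swap (suc i) zero          = zero
swap (suc i) (suc j)       = suc (swap i j)

s : ℕ → P → P
s i (con a) = con a
s i (x j)   = x (swap i j)
s i (f + g) = s i f + s i g
s i (f * g) = s i f * s i g
s i (- f)   = - s i f

∂-var : ℕ → ℕ → ℤ
∂-var zero    zero          = + 1
∂-var zero    (suc zero)    = ℤ.- (+ 1)
∂-var zero    (suc (suc j)) = + 0
∂-var (suc i) zero          = + 0
∂-var (suc i) (suc j)       = ∂-var i j

-- The twisted Leibniz rule computes the quotient (f − sᵢf)/(xᵢ − xᵢ₊₁);
-- ∂-quotient and ∂-unique below say that it is this quotient and that
-- the quotient is unique.

∂ : ℕ → P → P
∂ i (con a) = 0#
∂ i (x j)   = con (∂-var i j)
∂ i (f + g) = ∂ i f + ∂ i g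
∂ i (f * g) = ∂ i f * g + s i f * ∂ i g
∂ i (- f)   = - ∂ i f

θ : ℕ → P → P
θ i f = x (suc i) * ∂ i f

private
  -- substitutes xᵢ₊₁ for xᵢ
  merge : ℕ → ℕ → ℕ
  merge zero    zero    = 1
  merge zero    (suc j) = suc j
  merge (suc i) zero    = zero
  merge (suc i) (suc j) = suc (merge i j)

  ev : ℕ → P → P
  ev i (con a) = con a
  ev i (x j)   = x (merge i j)
  ev i (f + g) = ev i f + ev i g
  ev i (f * g) = ev i f * ev i g
  ev i (- f)   = - ev i f

  δ : ℕ → ℕ → ℤ
  δ zero    zero    = + 1
  δ zero    (suc j) = + 0
  δ (suc i) zero    = + 0
  δ (suc i) (suc j) = δ i j

  -- (f − ev i f)/(xᵢ − xᵢ₊₁)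
  D : ℕ → P → P
  D i (con a) = 0#
  D i (x j)   = con (δ i j)
  D i (f + g) = D i f + D i g
  D i (f * g) = D i f * g + ev i f * D i g
  D i (- f)   = - D i f

  open import Relation.Binary.Reasoning.Setoid setoid
  open P-Solver using (solve; con; _:+_; _:*_; _:-_; :-_; _:=_)

  x-quotient : ∀ k i j → (x (k ℕ.+ i) - x (k ℕ.+ suc i)) * con (∂-var i j)
                         ≈ x (k ℕ.+ j) - x (k ℕ.+ swap i j)
  x-quotient k zero zero =
    solve 2 (λ a b → (a :- b) :* con (+ 1) := a :- b) ≈-refl _ _
  x-quotient k zero (suc zero) =
    solve 2 (λ a b → (a :- b) :* con (ℤ.- (+ 1)) := b :- a) ≈-refl _ _
  x-quotient k zero (suc (suc j)) =
    solve 3 (λ a b c → (a :- b) :* con (+ 0) := c :- c) ≈-refl _ _ _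
  x-quotient k (suc i) zero =
    solve 3 (λ a b c → (a :- b) :* con (+ 0) := c :- c) ≈-refl _ _ _
  x-quotient k (suc i) (suc j)
    rewrite ℕ.+-suc k i | ℕ.+-suc k (suc i) | ℕ.+-suc k j | ℕ.+-suc k (swap i j)
    = x-quotient (suc k) i j

  x-D : ∀ k i j → (x (k ℕ.+ i) - x (k ℕ.+ suc i)) * con (δ i j)
                  ≈ x (k ℕ.+ j) - x (k ℕ.+ merge i j)
  x-D k zero zero =
    solve 2 (λ a b → (a :- b) :* con (+ 1) := a :- b) ≈-refl _ _
  x-D k zero (suc j) =
    solve 3 (λ a b c → (a :- b) :* con (+ 0) := c :- c) ≈-refl _ _ _
  x-D k (suc i) zero =
    solve 3 (λ a b c → (a :- b) :* con (+ 0) := c :- c) ≈-refl _ _ _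
  x-D k (suc i) (suc j)
    rewrite ℕ.+-suc k i | ℕ.+-suc k (suc i) | ℕ.+-suc k j | ℕ.+-suc k (merge i j)
    = x-D (suc k) i j

  +-step : ∀ d a b p q p′ q′ → d * a ≈ p - p′ → d * b ≈ q - q′ →
           d * (a + b) ≈ (p + q) - (p′ + q′)
  +-step d a b p q p′ q′ e₁ e₂ = begin
    d * (a + b)           ≈⟨ *-distribˡ d a b ⟩
    d * a + d * b         ≈⟨ +-cong e₁ e₂ ⟩
    (p - p′) + (q - q′)   ≈⟨ solve 4 (λ p q p′ q′ → (p :- p′) :+ (q :- q′)
                               := (p :+ q) :- (p′ :+ q′)) ≈-refl p q p′ q′ ⟩
    (p + q) - (p′ + q′)   ∎

  *-step : ∀ d a b p q p′ q′ → d * a ≈ p - p′ → d * b ≈ q - q′ →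
           d * (a * q + p′ * b) ≈ (p * q) - (p′ * q′)
  *-step d a b p q p′ q′ e₁ e₂ = begin
    d * (a * q + p′ * b)            ≈⟨ solve 5 (λ d a q p′ b → d :* (a :* q :+ p′ :* b)
                                         := (d :* a) :* q :+ p′ :* (d :* b)) ≈-refl d a q p′ b ⟩
    (d * a) * q + p′ * (d * b)      ≈⟨ +-cong (*-cong e₁ ≈-refl) (*-cong ≈-refl e₂) ⟩
    (p - p′) * q + p′ * (q - q′)    ≈⟨ solve 4 (λ p q p′ q′ → (p :- p′) :* q :+ p′ :* (q :- q′)
                                         := (p :* q) :- (p′ :* q′)) ≈-refl p q p′ q′ ⟩
    (p * q) - (p′ * q′)             ∎

  neg-step : ∀ d a p p′ → d * a ≈ p - p′ → d * (- a) ≈ (- p) - (- p′)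
  neg-step d a p p′ e = begin
    d * (- a)       ≈⟨ solve 2 (λ d a → d :* (:- a) := :- (d :* a)) ≈-refl d a ⟩
    - (d * a)       ≈⟨ neg-cong e ⟩
    - (p - p′)      ≈⟨ solve 2 (λ p p′ → :- (p :- p′) := (:- p) :- (:- p′)) ≈-refl p p′ ⟩
    (- p) - (- p′)  ∎

  con-step : ∀ d a → d * 0# ≈ con a - con a
  con-step d a = solve 2 (λ d c → d :* con (+ 0) := c :- c) ≈-refl d (P.con a)

∂-quotient : ∀ i f → (x i - x (suc i)) * ∂ i f ≈ f - s i f
∂-quotient i (con a) = con-step _ a
∂-quotient i (x j)   = x-quotient 0 i j
∂-quotient i (f + g) = +-step _ _ _ _ _ _ _ (∂-quotient i f) (∂-quotient i g)
∂-quotient i (f * g) = *-step _ _ _ _ _ _ _ (∂-quotient i f) (∂-quotient i g)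
∂-quotient i (- f)   = neg-step _ _ _ _ (∂-quotient i f)

private
  D-quotient : ∀ i f → (x i - x (suc i)) * D i f ≈ f - ev i f
  D-quotient i (con a) = con-step _ a
  D-quotient i (x j)   = x-D 0 i j
  D-quotient i (f + g) = +-step _ _ _ _ _ _ _ (D-quotient i f) (D-quotient i g)
  D-quotient i (f * g) = *-step _ _ _ _ _ _ _ (D-quotient i f) (D-quotient i g)
  D-quotient i (- f)   = neg-step _ _ _ _ (D-quotient i f)

  ev-cong : ∀ i {f g} → f ≈ g → ev i f ≈ ev i g
  ev-cong i ≈-refl            = ≈-refl
  ev-cong i (≈-sym p)         = ≈-sym (ev-cong i p)
  ev-cong i (≈-trans p q)     = ≈-trans (ev-cong i p) (ev-cong i q)
  ev-cong i (+-cong p q)      = +-cong (ev-cong i p) (ev-cong i q)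
  ev-cong i (*-cong p q)      = *-cong (ev-cong i p) (ev-cong i q)
  ev-cong i (neg-cong p)      = neg-cong (ev-cong i p)
  ev-cong i (+-assoc f g h)   = +-assoc _ _ _
  ev-cong i (+-comm f g)      = +-comm _ _
  ev-cong i (+-identityʳ f)   = +-identityʳ _
  ev-cong i (+-inverseʳ f)    = +-inverseʳ _
  ev-cong i (*-assoc f g h)   = *-assoc _ _ _
  ev-cong i (*-comm f g)      = *-comm _ _
  ev-cong i (*-identityʳ f)   = *-identityʳ _
  ev-cong i (*-distribˡ f g h) = *-distribˡ _ _ _
  ev-cong i (con-+ a b)       = con-+ a b
  ev-cong i (con-* a b)       = con-* a b

s-cong : ∀ i {f g} → f ≈ g → s i f ≈ s i g
s-cong i ≈-refl            = ≈-refl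
s-cong i (≈-sym p)         = ≈-sym (s-cong i p)
s-cong i (≈-trans p q)     = ≈-trans (s-cong i p) (s-cong i q)
s-cong i (+-cong p q)      = +-cong (s-cong i p) (s-cong i q)
s-cong i (*-cong p q)      = *-cong (s-cong i p) (s-cong i q)
s-cong i (neg-cong p)      = neg-cong (s-cong i p)
s-cong i (+-assoc f g h)   = +-assoc _ _ _
s-cong i (+-comm f g)      = +-comm _ _
s-cong i (+-identityʳ f)   = +-identityʳ _
s-cong i (+-inverseʳ f)    = +-inverseʳ _
s-cong i (*-assoc f g h)   = *-assoc _ _ _
s-cong i (*-comm f g)      = *-comm _ _
s-cong i (*-identityʳ f)   = *-identityʳ _
s-cong i (*-distribˡ f g h) = *-distribˡ _ _ _
s-cong i (con-+ a b)       = con-+ a b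
s-cong i (con-* a b)       = con-* a b

private
  -- (f − f′)/d · g + f′ · (g − g′)/d is symmetric in f and g without
  -- cancelling d, so ∂ respects commutativity.
  comm-step : ∀ d a b f g f′ g′ → d * a ≈ f - f′ → d * b ≈ g - g′ →
              a * g + f′ * b ≈ b * f + g′ * a
  comm-step d a b f g f′ g′ e₁ e₂ = begin
    a * g + f′ * b
      ≈⟨ solve 6 (λ a b f g f′ g′ → a :* g :+ f′ :* b
           := a :* (g :- g′) :+ g′ :* a :+ f :* b :- (f :- f′) :* b)
           ≈-refl a b f g f′ g′ ⟩
    a * (g - g′) + g′ * a + f * b - (f - f′) * b
      ≈⟨ +-cong (+-cong (+-cong (*-cong ≈-refl (≈-sym e₂)) ≈-refl) ≈-refl)
           (neg-cong (*-cong (≈-sym e₁) ≈-refl)) ⟩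
    a * (d * b) + g′ * a + f * b - (d * a) * b
      ≈⟨ solve 5 (λ a b d f g′ → a :* (d :* b) :+ g′ :* a :+ f :* b :- (d :* a) :* b
           := b :* f :+ g′ :* a) ≈-refl a b d f g′ ⟩
    b * f + g′ * a ∎

∂-cong : ∀ i {f g} → f ≈ g → ∂ i f ≈ ∂ i g
∂-cong i ≈-refl            = ≈-refl
∂-cong i (≈-sym p)         = ≈-sym (∂-cong i p)
∂-cong i (≈-trans p q)     = ≈-trans (∂-cong i p) (∂-cong i q)
∂-cong i (+-cong p q)      = +-cong (∂-cong i p) (∂-cong i q)
∂-cong i (*-cong p q)      =
  +-cong (*-cong (∂-cong i p) q) (*-cong (s-cong i p) (∂-cong i q))
∂-cong i (neg-cong p)      = neg-cong (∂-cong i p)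
∂-cong i (+-assoc f g h)   = +-assoc _ _ _
∂-cong i (+-comm f g)      = +-comm _ _
∂-cong i (+-identityʳ f)   = +-identityʳ _
∂-cong i (+-inverseʳ f)    = +-inverseʳ _
∂-cong i (*-assoc f g h)   =
  solve 7 (λ a b c g h f′ g′ →
      (a :* g :+ f′ :* b) :* h :+ (f′ :* g′) :* c
      := a :* (g :* h) :+ f′ :* (b :* h :+ g′ :* c))
    ≈-refl (∂ i f) (∂ i g) (∂ i h) g h (s i f) (s i g)
∂-cong i (*-comm f g)      =
  comm-step (x i - x (suc i)) _ _ _ _ _ _ (∂-quotient i f) (∂-quotient i g)
∂-cong i (*-identityʳ f)   =
  solve 2 (λ a f′ → a :* con (+ 1) :+ f′ :* con (+ 0) := a) ≈-refl (∂ i f) (s i f)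
∂-cong i (*-distribˡ f g h) =
  solve 6 (λ a b c g h f′ →
      a :* (g :+ h) :+ f′ :* (b :+ c) := (a :* g :+ f′ :* b) :+ (a :* h :+ f′ :* c))
    ≈-refl (∂ i f) (∂ i g) (∂ i h) g h (s i f)
∂-cong i (con-+ a b)       = ≈-sym (+-identityʳ _)
∂-cong i (con-* a b)       =
  solve 2 (λ p q → con (+ 0) := con (+ 0) :* q :+ p :* con (+ 0)) ≈-refl (P.con a) (P.con b)

θ-cong : ∀ i {f g} → f ≈ g → θ i f ≈ θ i g
θ-cong i p = *-cong ≈-refl (∂-cong i p)

private
  D-cong : ∀ i {f g} → f ≈ g → D i f ≈ D i g
  D-cong i ≈-refl            = ≈-refl
  D-cong i (≈-sym p)         = ≈-sym (D-cong i p)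
  D-cong i (≈-trans p q)     = ≈-trans (D-cong i p) (D-cong i q)
  D-cong i (+-cong p q)      = +-cong (D-cong i p) (D-cong i q)
  D-cong i (*-cong p q)      =
    +-cong (*-cong (D-cong i p) q) (*-cong (ev-cong i p) (D-cong i q))
  D-cong i (neg-cong p)      = neg-cong (D-cong i p)
  D-cong i (+-assoc f g h)   = +-assoc _ _ _
  D-cong i (+-comm f g)      = +-comm _ _
  D-cong i (+-identityʳ f)   = +-identityʳ _
  D-cong i (+-inverseʳ f)    = +-inverseʳ _
  D-cong i (*-assoc f g h)   =
    solve 7 (λ a b c g h f′ g′ →
        (a :* g :+ f′ :* b) :* h :+ (f′ :* g′) :* c
        := a :* (g :* h) :+ f′ :* (b :* h :+ g′ :* c))
      ≈-refl (D i f) (D i g) (D i h) g h (ev i f) (ev i g)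
  D-cong i (*-comm f g)      =
    comm-step (x i - x (suc i)) _ _ _ _ _ _ (D-quotient i f) (D-quotient i g)
  D-cong i (*-identityʳ f)   =
    solve 2 (λ a f′ → a :* con (+ 1) :+ f′ :* con (+ 0) := a) ≈-refl (D i f) (ev i f)
  D-cong i (*-distribˡ f g h) =
    solve 6 (λ a b c g h f′ →
        a :* (g :+ h) :+ f′ :* (b :+ c) := (a :* g :+ f′ :* b) :+ (a :* h :+ f′ :* c))
      ≈-refl (D i f) (D i g) (D i h) g h (ev i f)
  D-cong i (con-+ a b)       = ≈-sym (+-identityʳ _)
  D-cong i (con-* a b)       =
    solve 2 (λ p q → con (+ 0) := con (+ 0) :* q :+ p :* con (+ 0)) ≈-refl (P.con a) (P.con b)

  δ-refl : ∀ i → δ i i ≡ + 1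
  δ-refl zero    = ≡.refl
  δ-refl (suc i) = δ-refl i

  δ-suc : ∀ i → δ i (suc i) ≡ + 0
  δ-suc zero    = ≡.refl
  δ-suc (suc i) = δ-suc i

  merge-refl : ∀ i → merge i i ≡ suc i
  merge-refl zero    = ≡.refl
  merge-refl (suc i) = cong suc (merge-refl i)

  merge-suc : ∀ i → merge i (suc i) ≡ suc i
  merge-suc zero    = ≡.refl
  merge-suc (suc i) = cong suc (merge-suc i)

  D-cancel : ∀ i h → D i ((x i - x (suc i)) * h) ≈ h
  D-cancel i h rewrite δ-refl i | δ-suc i | merge-refl i | merge-suc i =
    solve 3 (λ h b k → (con (+ 1) :- con (+ 0)) :* h :+ (b :- b) :* k := h)
      ≈-refl h (x (suc i)) (D i h)

x-x-cancel : ∀ i {g h} → (x i - x (suc i)) * g ≈ (x i - x (suc i)) * h → g ≈ h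
x-x-cancel i {g} {h} p =
  ≈-trans (≈-sym (D-cancel i g)) (≈-trans (D-cong i p) (D-cancel i h))

∂-unique : ∀ i f h → (x i - x (suc i)) * h ≈ f - s i f → h ≈ ∂ i f
∂-unique i f h p = x-x-cancel i (≈-trans p (≈-sym (∂-quotient i f)))

-- A letter of Letter n is a 0-based position i with i + 1 < n, standing for
-- the simple transposition of positions i and i + 1.

data Letter : ℕ → Set where
  zero : Letter (suc (suc n))
  suc  : Letter n → Letter (suc n)

lower upper : Letter n → Fin n
lower zero    = zero
lower (suc i) = suc (lower i)
upper zero    = suc zero
upper (suc i) = suc (upper i)

Word : ℕ → Set
Word n = List (Letter n)

σ : Letter n → Permutation′ n
σ i = transpose (lower i) (upper i)

-- _∘ₚ_ applies its left argument first.

⟦_⟧ : Word n → Permutation′ n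
⟦_⟧ = foldr (λ i w → w ∘ₚ σ i) Perm.id

record Reduced (w : Permutation′ n) (is : Word n) : Set where
  field
    product  : ⟦ is ⟧ Perm.≈ w
    shortest : ∀ js → ⟦ js ⟧ Perm.≈ w → length is ≤ length js

infixr 7 _·_

-- Left action: the j-th entry moves to position w(j).

_·_ : Permutation′ n → Vec ℕ n → Vec ℕ n
w · γ = tabulate (λ j → lookup γ (w ⟨$⟩ˡ j))

θ-word : Word n → P → P
θ-word is f = foldr (λ i → θ (toℕ (lower i))) f is

IsPartition : Vec ℕ n → Set
IsPartition = Linked _≥_

-- w has minimal length among the permutations taking the sorted shape to γ,
-- length being the length of a reduced word.

record Straightening (γ : Vec ℕ n) : Set where
  field
    shape       : Vec ℕ n
    isPartition : IsPartition shape
    w           : Permutation′ n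
    w·shape     : w · shape ≡ γ
    word        : Word n
    reduced     : Reduced w word
    minimal     : ∀ {w′ word′} → w′ · shape ≡ γ → Reduced w′ word′ →
                  length word ≤ length word′

-- Straightenings exist: decreasing insertion sort, recording the swaps.

insert : ℕ → Vec ℕ n → Vec ℕ (suc n)
insert a []      = a ∷ []
insert a (b ∷ γ) with a ℕ.<? b
... | yes _ = b ∷ insert a γ
... | no  _ = a ∷ b ∷ γ

insert-word : ℕ → Vec ℕ n → Word (suc n)
insert-word a []      = []
insert-word a (b ∷ γ) with a ℕ.<? b
... | yes _ = zero ∷ List.map suc (insert-word a γ)
... | no  _ = []

sort : Vec ℕ n → Vec ℕ n
sort []      = []
sort (a ∷ γ) = insert a (sort γ)

sort-word : Vec ℕ n → Word n
sort-word []      = []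
sort-word (a ∷ γ) = List.map suc (sort-word γ) ++ insert-word a (sort γ)

swapAt : Letter n → Vec ℕ n → Vec ℕ n
swapAt zero    (a ∷ b ∷ γ) = b ∷ a ∷ γ
swapAt (suc i) (a ∷ γ)     = a ∷ swapAt i γ

swaps : Word n → Vec ℕ n → Vec ℕ n
swaps is γ = foldr swapAt γ is

above : ℕ → Vec ℕ n → ℕ
above a []      = 0
above a (b ∷ γ) with a ℕ.<? b
... | yes _ = suc (above a γ)
... | no  _ = above a γ

inversions : Vec ℕ n → ℕ
inversions []      = 0
inversions (a ∷ γ) = above a γ ℕ.+ inversions γ

transpose-suc : ∀ (i j k : Fin n) →
  transpose (suc i) (suc j) ⟨$⟩ʳ suc k ≡ suc (transpose i j ⟨$⟩ʳ k)
transpose-suc i j k with k Fin.≟ i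
... | yes _ = ≡.refl
... | no  _ with k Fin.≟ j
...   | yes _ = ≡.refl
...   | no  _ = ≡.refl

lookup-σ : ∀ (i : Letter n) γ j →
           lookup γ (σ i ⟨$⟩ˡ j) ≡ lookup (swapAt i γ) j
lookup-σ zero (a ∷ b ∷ γ) zero          = ≡.refl
lookup-σ zero (a ∷ b ∷ γ) (suc zero)    = ≡.refl
lookup-σ zero (a ∷ b ∷ γ) (suc (suc j)) = ≡.refl
lookup-σ (suc i) (a ∷ γ) zero           = ≡.refl
lookup-σ (suc i) (a ∷ γ) (suc j)        =
  ≡.trans (cong (lookup (a ∷ γ)) (transpose-suc (upper i) (lower i) j))
          (lookup-σ i γ j)

σ·-swapAt : ∀ (i : Letter n) γ → σ i · γ ≡ swapAt i γ
σ·-swapAt i γ =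
  ≡.trans (Vec.tabulate-cong (lookup-σ i γ)) (Vec.tabulate∘lookup (swapAt i γ))

⟦⟧·-swaps : ∀ (is : Word n) γ → ⟦ is ⟧ · γ ≡ swaps is γ
⟦⟧·-swaps []       γ = Vec.tabulate∘lookup γ
⟦⟧·-swaps (i ∷ is) γ =
  ≡.trans (Vec.tabulate-cong (λ j →
            ≡.sym (Vec.lookup∘tabulate (λ k → lookup γ (⟦ is ⟧ ⟨$⟩ˡ k)) (σ i ⟨$⟩ˡ j))))
  (≡.trans (cong (σ i ·_) (⟦⟧·-swaps is γ)) (σ·-swapAt i (swaps is γ)))

·-cong : ∀ {v w : Permutation′ n} → v Perm.≈ w → ∀ γ → v · γ ≡ w · γ
·-cong {v = v} {w} v≈w γ = Vec.tabulate-cong (λ j → cong (lookup γ) (from≡ j))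
  where
  from≡ : ∀ j → v ⟨$⟩ˡ j ≡ w ⟨$⟩ˡ j
  from≡ j = ≡.trans (cong (v ⟨$⟩ˡ_) (≡.sym (≡.trans (v≈w (w ⟨$⟩ˡ j)) (Perm.inverseʳ w))))
                     (Perm.inverseˡ v)

swaps-++ : ∀ (is js : Word n) γ → swaps (is ++ js) γ ≡ swaps is (swaps js γ)
swaps-++ is js γ = List.foldr-++ swapAt γ is js

swaps-suc : ∀ (is : Word n) a γ → swaps (List.map suc is) (a ∷ γ) ≡ a ∷ swaps is γ
swaps-suc []       a γ = ≡.refl
swaps-suc (i ∷ is) a γ = cong (swapAt (suc i)) (swaps-suc is a γ)

swaps-insert : ∀ a (γ : Vec ℕ n) → swaps (insert-word a γ) (insert a γ) ≡ a ∷ γ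
swaps-insert a []      = ≡.refl
swaps-insert a (b ∷ γ) with a ℕ.<? b
... | yes _ = cong (swapAt zero)
                (≡.trans (swaps-suc (insert-word a γ) b (insert a γ))
                         (cong (b ∷_) (swaps-insert a γ)))
... | no  _ = ≡.refl

swaps-sort : ∀ (γ : Vec ℕ n) → swaps (sort-word γ) (sort γ) ≡ γ
swaps-sort []      = ≡.refl
swaps-sort (a ∷ γ) =
  ≡.trans (swaps-++ (List.map suc (sort-word γ)) (insert-word a (sort γ)) _)
  (≡.trans (cong (swaps (List.map suc (sort-word γ))) (swaps-insert a (sort γ)))
  (≡.trans (swaps-suc (sort-word γ) a (sort γ))
           (cong (a ∷_) (swaps-sort γ))))

insert-partition : ∀ a {γ : Vec ℕ n} → IsPartition γ → IsPartition (insert a γ)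
insert-partition a []  = [-]
insert-partition a {b ∷ []} [-] with a ℕ.<? b
... | yes a<b = ℕ.<⇒≤ a<b ∷ [-]
... | no  a≮b = ℕ.≮⇒≥ a≮b ∷ [-]
insert-partition a {b ∷ c ∷ γ} (b≥c ∷ p) with a ℕ.<? b
... | no  a≮b = ℕ.≮⇒≥ a≮b ∷ (b≥c ∷ p)
... | yes a<b with a ℕ.<? c | insert-partition a p
...   | yes _ | q = b≥c ∷ q
...   | no  _ | q = ℕ.<⇒≤ a<b ∷ q

sort-partition : ∀ (γ : Vec ℕ n) → IsPartition (sort γ)
sort-partition []      = []
sort-partition (a ∷ γ) = insert-partition a (sort-partition γ)

above-partition : ∀ {a b} {γ : Vec ℕ n} → b ≤ a → IsPartition (b ∷ γ) → above a γ ≡ 0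
above-partition b≤a [-] = ≡.refl
above-partition {a = a} {γ = c ∷ γ} b≤a (b≥c ∷ p) with a ℕ.<? c
... | yes a<c = contradiction (ℕ.≤-trans b≥c b≤a) (ℕ.<⇒≱ a<c)
... | no  _   = above-partition (ℕ.≤-trans b≥c b≤a) p

inversions-partition : ∀ {γ : Vec ℕ n} → IsPartition γ → inversions γ ≡ 0
inversions-partition []  = ≡.refl
inversions-partition [-] = ≡.refl
inversions-partition {γ = a ∷ γ} (a≥b ∷ p) =
  cong₂ ℕ._+_ (above-partition {γ = γ} ℕ.≤-refl (a≥b ∷ p)) (inversions-partition p)

above-swapAt : ∀ a (i : Letter n) γ → above a (swapAt i γ) ≡ above a γ
above-swapAt a zero (b ∷ c ∷ γ) with a ℕ.<? b in p | a ℕ.<? c in q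
... | yes _ | yes _ rewrite p | q = ≡.refl
... | yes _ | no  _ rewrite p | q = ≡.refl
... | no  _ | yes _ rewrite p | q = ≡.refl
... | no  _ | no  _ rewrite p | q = ≡.refl
above-swapAt a (suc i) (b ∷ γ) with a ℕ.<? b
... | yes _ = cong suc (above-swapAt a i γ)
... | no  _ = above-swapAt a i γ

above-swaps : ∀ a (is : Word n) γ → above a (swaps is γ) ≡ above a γ
above-swaps a []       γ = ≡.refl
above-swaps a (i ∷ is) γ = ≡.trans (above-swapAt a i (swaps is γ)) (above-swaps a is γ)

above-≤ : ∀ a b (γ : Vec ℕ n) → above a (b ∷ γ) ≤ suc (above a γ)
above-≤ a b γ with a ℕ.<? b
... | yes _ = ℕ.≤-refl
... | no  _ = ℕ.n≤1+n _

above-≥ : ∀ a b (γ : Vec ℕ n) → above a γ ≤ above a (b ∷ γ)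
above-≥ a b γ with a ℕ.<? b
... | yes _ = ℕ.n≤1+n _
... | no  _ = ℕ.≤-refl

inversions-swapAt : ∀ (i : Letter n) γ → inversions (swapAt i γ) ≤ suc (inversions γ)
inversions-swapAt zero (a ∷ b ∷ γ) =
  ℕ.≤-trans
    (ℕ.+-mono-≤ (above-≤ b a γ) (ℕ.+-monoˡ-≤ I (above-≥ a b γ)))
    (ℕ.≤-reflexive (cong suc
      (≡.trans (≡.sym (ℕ.+-assoc B A′ I))
      (≡.trans (cong (ℕ._+ I) (ℕ.+-comm B A′)) (ℕ.+-assoc A′ B I)))))
  where
  I  = inversions γ
  B  = above b γ
  A′ = above a (b ∷ γ)
inversions-swapAt (suc i) (a ∷ γ) rewrite above-swapAt a i γ =
  ℕ.≤-trans (ℕ.+-monoʳ-≤ (above a γ) (inversions-swapAt i γ))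
            (ℕ.≤-reflexive (ℕ.+-suc (above a γ) (inversions γ)))

inversions-swaps : ∀ (is : Word n) γ → inversions (swaps is γ) ≤ length is ℕ.+ inversions γ
inversions-swaps []       γ = ℕ.≤-refl
inversions-swaps (i ∷ is) γ =
  ℕ.≤-trans (inversions-swapAt i (swaps is γ)) (s≤s (inversions-swaps is γ))

length-insert-word : ∀ a {γ : Vec ℕ n} → IsPartition γ → length (insert-word a γ) ≡ above a γ
length-insert-word a {[]} p = ≡.refl
length-insert-word a {b ∷ γ} p with a ℕ.<? b
... | no  a≮b = ≡.sym (above-partition (ℕ.≮⇒≥ a≮b) p)
... | yes _   = cong suc (≡.trans (List.length-map suc (insert-word a γ))
                                  (length-insert-word a (tail p)))
  where open import Data.Vec.Relation.Unary.Linked using (tail)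

length-sort-word : ∀ (γ : Vec ℕ n) → length (sort-word γ) ≡ inversions γ
length-sort-word []      = ≡.refl
length-sort-word (a ∷ γ) =
  ≡.trans (List.length-++ (List.map suc (sort-word γ)))
  (≡.trans (cong₂ ℕ._+_
      (≡.trans (List.length-map suc (sort-word γ)) (length-sort-word γ))
      (≡.trans (length-insert-word a (sort-partition γ))
      (≡.trans (≡.sym (above-swaps a (sort-word γ) (sort γ)))
               (cong (above a) (swaps-sort γ)))))
    (ℕ.+-comm (inversions γ) (above a γ)))

sort-word-minimal : ∀ (γ : Vec ℕ n) js → ⟦ js ⟧ · sort γ ≡ γ →
                    length (sort-word γ) ≤ length js
sort-word-minimal γ js p
  rewrite length-sort-word γ =
  ≡.subst₂ _≤_
    (cong inversions (≡.trans (≡.sym (⟦⟧·-swaps js (sort γ))) p))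
    (≡.trans (cong (length js ℕ.+_) (inversions-partition (sort-partition γ)))
             (ℕ.+-identityʳ (length js)))
    (inversions-swaps js (sort γ))

straighten : (γ : Vec ℕ n) → Straightening γ
straighten γ = record
  { shape       = sort γ
  ; isPartition = sort-partition γ
  ; w           = ⟦ sort-word γ ⟧
  ; w·shape     = w·sort
  ; word        = sort-word γ
  ; reduced     = record
    { product  = λ _ → ≡.refl
    ; shortest = λ js p → sort-word-minimal γ js
        (≡.trans (·-cong {v = ⟦ js ⟧} {w = ⟦ sort-word γ ⟧} p (sort γ)) w·sort)
    }
  ; minimal     = λ {w′} {js} p r → sort-word-minimal γ js
      (≡.trans (·-cong {v = ⟦ js ⟧} {w = w′} (Reduced.product r) (sort γ)) p)
  }
  where
  w·sort : ⟦ sort-word γ ⟧ · sort γ ≡ γ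
  w·sort = ≡.trans (⟦⟧·-swaps (sort-word γ) (sort γ)) (swaps-sort γ)

-- θ_w x^λ; θ_w does not depend on the reduced word of w, so the one supplied
-- by straighten is used.

𝒜 : Vec ℕ n → P
𝒜 γ = θ-word word (x^ shape)
  where open Straightening (straighten γ)

WeakComposition : Set
WeakComposition = ∃ (Vec ℕ)

Σ-𝒜 : List (ℕ × WeakComposition) → P
Σ-𝒜 = foldr (λ (c , _ , β) f → con (+ c) * 𝒜 β + f) 0#

-- The finitely supported family (c_β) is given as a finite list of pairs
-- (c , β); a repeated β contributes the sum of its coefficients.

AtomPositive : P → Set
AtomPositive f = Σ[ cs ∈ List (ℕ × WeakComposition) ] f ≈ Σ-𝒜 cs

{-# OPTIONS --safe #-}

-- Every x^μ is a product of monomials ω_k = x₁⋯x_k, so it suffices to multiply by one ω_k, keeping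
-- n parts.  Write π_i = 1 + θ_i.  A reduced word of w splits as u v, where u permutes {1,…,k} and {k+1,…,n}
-- separately and v is a minimal coset representative.  Then ω_k commutes with θ_u, and
-- x_i θ_i = π_i x_{i+1} turns ω_k θ_v into π_v x^ε with a 0/1-vector ε for which ε + λ is a partition:
--   ω_k θ_w x^λ = θ_u π_v x^{ε+λ}.
-- Since θ_y π_i is θ_y + θ_{y s_i} or 0, the operator θ_u π_v is a nonnegative combination of θ_y's,
-- and each θ_y sends x^{ε+λ} to an atom or to 0.

module Submission where

open import Algebra.Bundles using (CommutativeRing)
open import Data.Fin.Base using (toℕ)
open import Data.Integer.Base as ℤ using (+_)
open import Data.List.Base as List using (List; []; _∷_; foldr)
import Data.List.Properties as List
open import Data.Nat.Base as ℕ using (ℕ; zero; suc; _≤_; _<_; z≤n; s≤s)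
import Data.Nat.Properties as ℕ
open import Data.Product.Base using (Σ-syntax; _×_; _,_)
open import Data.Sum.Base using (_⊎_; inj₁; inj₂)
open import Data.Vec.Base as Vec using (Vec; []; _∷_; _++_; replicate; zipWith)
open import Data.Vec.Relation.Unary.All using (All; []; _∷_)
open import Data.Vec.Relation.Unary.Linked as Linked using ([]; [-]; _∷_)
open import Relation.Binary.Definitions using (tri<; tri≈; tri>)
open import Relation.Binary.PropositionalEquality as ≡ using (_≡_; cong; cong₂)
open import Relation.Nullary using (yes; no; contradiction)
open import Defs
open CommutativeRing P-commutativeRing
  using (*-congˡ; *-congʳ; +-congˡ; +-identityˡ; *-identityˡ; zeroʳ; reflexive)
open import Algebra.Properties.CommutativeSemiring.Exp
  (CommutativeRing.commutativeSemiring P-commutativeRing) using (^-homo-*; ^-distrib-*; ^-congˡ)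
open P-Solver using (solve; con; _:+_; _:*_; _:-_; :-_; _:=_)
open import Relation.Binary.Reasoning.Setoid setoid

-- Permutations enter only through Lehmer codes. A code fixes one reduced word, a product of cycles
-- of adjacent positions, so facts about θ_w become inductions on vectors in which a single θ_i is
-- pushed through a single cycle.
--
-- The dichotomy for θ_y π_i rests on θ_i θ_i = -θ_i: if y ends in s_i, then θ_y θ_i = -θ_y and the
-- two terms cancel.
--
-- ε + λ is a partition because `insert` puts an entry in front of its equals. Inside a run of equal
-- entries of λ, those coming from the first k positions therefore stand first, and exactly these
-- are raised by one.
--
-- For a partition σ, θ_j kills x^σ whenever σ_j = σ_{j+1}. Either y is shortest in its coset modulo
-- the stabilizer of σ, and its code is then the code of a rearrangement of σ, or y has a reduced
-- word ending in such an s_j.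

private
  variable
    m n p q i j k r : ℕ
    f g : P

-- Transpositions of the variables

swap-lower : ∀ i → swap i i ≡ suc i
swap-lower zero    = ≡.refl
swap-lower (suc i) = cong suc (swap-lower i)

swap-upper : ∀ i → swap i (suc i) ≡ i
swap-upper zero    = ≡.refl
swap-upper (suc i) = cong suc (swap-upper i)

swap-below : j < i → swap i j ≡ j
swap-below {zero}  {suc i} (s≤s _)   = ≡.refl
swap-below {suc j} {suc i} (s≤s j<i) = cong suc (swap-below j<i)

swap-above : suc i < j → swap i j ≡ j
swap-above {zero}  {suc zero}    (s≤s ())
swap-above {zero}  {suc (suc j)} _         = ≡.refl
swap-above {suc i} {suc j}       (s≤s i<j) = cong suc (swap-above i<j)

swap-involutive : ∀ i j → swap i (swap i j) ≡ j
swap-involutive zero    zero          = ≡.refl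
swap-involutive zero    (suc zero)    = ≡.refl
swap-involutive zero    (suc (suc j)) = ≡.refl
swap-involutive (suc i) zero          = ≡.refl
swap-involutive (suc i) (suc j)       = cong suc (swap-involutive i j)

swap-comm : suc i < j → ∀ k → swap i (swap j k) ≡ swap j (swap i k)
swap-comm {zero}  {suc zero}    (s≤s ())
swap-comm {zero}  {suc (suc j)} _         zero          = ≡.refl
swap-comm {zero}  {suc (suc j)} _         (suc zero)    = ≡.refl
swap-comm {zero}  {suc (suc j)} _         (suc (suc k)) = ≡.refl
swap-comm {suc i} {suc j}       _         zero          = ≡.refl
swap-comm {suc i} {suc j}       (s≤s i<j) (suc k)       = cong suc (swap-comm i<j k)

swap-braid : ∀ i k → swap i (swap (suc i) (swap i k)) ≡ swap (suc i) (swap i (swap (suc i) k))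
swap-braid zero    zero                = ≡.refl
swap-braid zero    (suc zero)          = ≡.refl
swap-braid zero    (suc (suc zero))    = ≡.refl
swap-braid zero    (suc (suc (suc k))) = ≡.refl
swap-braid (suc i) zero                = ≡.refl
swap-braid (suc i) (suc k)             = cong suc (swap-braid i k)

∂-var-swap : suc i < j → ∀ k → ∂-var j (swap i k) ≡ ∂-var j k
∂-var-swap {zero}  {suc zero}    (s≤s ())
∂-var-swap {zero}  {suc (suc j)} _         zero          = ≡.refl
∂-var-swap {zero}  {suc (suc j)} _         (suc zero)    = ≡.refl
∂-var-swap {zero}  {suc (suc j)} _         (suc (suc k)) = ≡.refl
∂-var-swap {suc i} {suc j}       _         zero          = ≡.refl
∂-var-swap {suc i} {suc j}       (s≤s i<j) (suc k)       = ∂-var-swap i<j k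

∂-var-upper : ∀ i → ∂-var i (suc i) ≡ ℤ.- (+ 1)
∂-var-upper zero    = ≡.refl
∂-var-upper (suc i) = ∂-var-upper i

s-lower : ∀ i → s i (x i) ≈ x (suc i)
s-lower i = reflexive (cong x (swap-lower i))

s-upper : ∀ i → s i (x (suc i)) ≈ x i
s-upper i = reflexive (cong x (swap-upper i))

s-below : j < i → s i (x j) ≈ x j
s-below j<i = reflexive (cong x (swap-below j<i))

s-above : suc i < j → s i (x j) ≈ x j
s-above i<j = reflexive (cong x (swap-above i<j))

s-involutive : ∀ i f → s i (s i f) ≡ f
s-involutive i (con a) = ≡.refl
s-involutive i (x j)   = cong x (swap-involutive i j)
s-involutive i (f + g) = cong₂ _+_ (s-involutive i f) (s-involutive i g)
s-involutive i (f * g) = cong₂ _*_ (s-involutive i f) (s-involutive i g)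
s-involutive i (- f)   = cong -_ (s-involutive i f)

s-comm : suc i < j → ∀ f → s i (s j f) ≡ s j (s i f)
s-comm i<j (con a) = ≡.refl
s-comm i<j (x k)   = cong x (swap-comm i<j k)
s-comm i<j (f + g) = cong₂ _+_ (s-comm i<j f) (s-comm i<j g)
s-comm i<j (f * g) = cong₂ _*_ (s-comm i<j f) (s-comm i<j g)
s-comm i<j (- f)   = cong -_ (s-comm i<j f)

s-braid : ∀ i f → s i (s (suc i) (s i f)) ≡ s (suc i) (s i (s (suc i) f))
s-braid i (con a) = ≡.refl
s-braid i (x k)   = cong x (swap-braid i k)
s-braid i (f + g) = cong₂ _+_ (s-braid i f) (s-braid i g)
s-braid i (f * g) = cong₂ _*_ (s-braid i f) (s-braid i g)
s-braid i (- f)   = cong -_ (s-braid i f)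

∂-s-comm : suc i < j → ∀ f → ∂ j (s i f) ≡ s i (∂ j f)
∂-s-comm i<j (con a) = ≡.refl
∂-s-comm i<j (x k)   = cong con (∂-var-swap i<j k)
∂-s-comm i<j (f + g) = cong₂ _+_ (∂-s-comm i<j f) (∂-s-comm i<j g)
∂-s-comm i<j (f * g) = cong₂ _+_
  (cong₂ _*_ (∂-s-comm i<j f) ≡.refl)
  (cong₂ _*_ (≡.sym (s-comm i<j f)) (∂-s-comm i<j g))
∂-s-comm i<j (- f)   = cong -_ (∂-s-comm i<j f)

-- Divided differences

-‿cong₂ : ∀ {f f′ g g′} → f ≈ f′ → g ≈ g′ → f - g ≈ f′ - g′
-‿cong₂ e₁ e₂ = +-cong e₁ (neg-cong e₂)

∂-invariant : s i g ≈ g → ∂ i g ≈ 0#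
∂-invariant {i} {g} e = ≈-sym (∂-unique i g 0# (begin
  (x i - x (suc i)) * 0#  ≈⟨ solve 2 (λ d g → d :* con (+ 0) := g :- g) ≈-refl _ g ⟩
  g - g                   ≈⟨ -‿cong₂ ≈-refl (≈-sym e) ⟩
  g - s i g               ∎))

∂-*-invariant : s i g ≈ g → ∀ f → ∂ i (g * f) ≈ g * ∂ i f
∂-*-invariant {i} {g} e f = begin
  ∂ i g * f + s i g * ∂ i f  ≈⟨ +-cong (*-congʳ (∂-invariant e)) (*-congʳ e) ⟩
  0# * f + g * ∂ i f         ≈⟨ solve 3 (λ f g d → con (+ 0) :* f :+ g :* d := g :* d) ≈-refl f g _ ⟩
  g * ∂ i f                  ∎

-- Numerator and denominator of the divided difference both change sign under `s i`.
s∂≈∂ : ∀ i f → s i (∂ i f) ≈ ∂ i f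
s∂≈∂ i f = ∂-unique i f (s i (∂ i f)) (begin
  (x i - x (suc i)) * s i (∂ i f)
    ≈⟨ solve 3 (λ a b c → (a :- b) :* c := :- ((b :- a) :* c)) ≈-refl (x i) (x (suc i)) _ ⟩
  - ((x (suc i) - x i) * s i (∂ i f))
    ≈⟨ neg-cong (*-congʳ (-‿cong₂ (≈-sym (s-lower i)) (≈-sym (s-upper i)))) ⟩
  - s i ((x i - x (suc i)) * ∂ i f)
    ≈⟨ neg-cong (s-cong i (∂-quotient i f)) ⟩
  - (s i f - s i (s i f))
    ≈⟨ neg-cong (-‿cong₂ ≈-refl (reflexive (s-involutive i f))) ⟩
  - (s i f - f)
    ≈⟨ solve 2 (λ a b → :- (a :- b) := b :- a) ≈-refl (s i f) f ⟩
  f - s i f ∎)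

∂∂≈0 : ∀ i f → ∂ i (∂ i f) ≈ 0#
∂∂≈0 i f = ∂-invariant (s∂≈∂ i f)

∂-comm : suc i < j → ∀ f → ∂ i (∂ j f) ≈ ∂ j (∂ i f)
∂-comm {i} {j} i<j f = ≈-sym (∂-unique i (∂ j f) (∂ j (∂ i f)) (begin
  (x i - x (suc i)) * ∂ j (∂ i f)
    ≈⟨ ∂-*-invariant (-‿cong₂ (s-below (ℕ.<-trans ℕ.≤-refl i<j)) (s-below i<j)) (∂ i f) ⟨
  ∂ j ((x i - x (suc i)) * ∂ i f)  ≈⟨ ∂-cong j (∂-quotient i f) ⟩
  ∂ j f - ∂ j (s i f)              ≈⟨ -‿cong₂ ≈-refl (reflexive (∂-s-comm i<j f)) ⟩
  ∂ j f - s i (∂ j f)              ∎))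

-- Multiplying by (xᵢ − xᵢ₊₁)(xᵢ₊₁ − xᵢ₊₂)(xᵢ − xᵢ₊₂) turns either side of the braid relation
-- into the alternating sum of f over S₃.
∂-braid : ∀ i f → ∂ i (∂ (suc i) (∂ i f)) ≈ ∂ (suc i) (∂ i (∂ (suc i) f))
∂-braid i f =
  x-x-cancel i (x-x-cancel (suc i) (cancel₁₃ (≈-trans left (≈-sym right))))
  where
  t = suc i
  a = x i
  b = x t
  c = x (suc t)

  -- `x-x-cancel` handles only neighbouring variables; applying `s t` turns `a - c` into `a - b`.
  cancel₁₃ : ∀ {g h} → (a - c) * g ≈ (a - c) * h → g ≈ h
  cancel₁₃ {g} {h} e = begin
    g          ≈⟨ reflexive (s-involutive t g) ⟨
    s t (s t g)
      ≈⟨ s-cong t (x-x-cancel i (≈-trans (≈-sym (dist g)) (≈-trans (s-cong t e) (dist h)))) ⟩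
    s t (s t h) ≈⟨ reflexive (s-involutive t h) ⟩
    h ∎
    where
    dist : ∀ g → s t ((a - c) * g) ≈ (a - b) * s t g
    dist g = *-congʳ (-‿cong₂ (s-below ℕ.≤-refl) (s-upper t))

  alt : P
  alt = f - s i f - s t f + s t (s i f) + s i (s t f) - s i (s t (s i f))

  left : (a - c) * ((b - c) * ((a - b) * ∂ i (∂ t (∂ i f)))) ≈ alt
  left = begin
    (a - c) * ((b - c) * ((a - b) * ∂ i F))
      ≈⟨ *-congˡ (*-congˡ (∂-quotient i F)) ⟩
    (a - c) * ((b - c) * (F - s i F))
      ≈⟨ solve 5 (λ a b c F F′ → (a :- c) :* ((b :- c) :* (F :- F′))
           := (a :- c) :* ((b :- c) :* F) :- (b :- c) :* ((a :- c) :* F′)) ≈-refl a b c F (s i F) ⟩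
    (a - c) * ((b - c) * F) - (b - c) * ((a - c) * s i F)
      ≈⟨ -‿cong₂ (*-congˡ (∂-quotient t G)) (*-congˡ (≈-trans
           (*-congʳ (-‿cong₂ (≈-sym (s-upper i)) (≈-sym (s-above ℕ.≤-refl))))
           (≈-trans (s-cong i (∂-quotient t G)) (-‿cong₂ (s∂≈∂ i f) ≈-refl)))) ⟩
    (a - c) * (G - s t G) - (b - c) * (G - s i (s t G))
      ≈⟨ solve 6 (λ a b c G G₂ G₁₂ → (a :- c) :* (G :- G₂) :- (b :- c) :* (G :- G₁₂)
           := (a :- b) :* G :- (a :- c) :* G₂ :+ (b :- c) :* G₁₂) ≈-refl a b c G _ _ ⟩
    (a - b) * G - (a - c) * s t G + (b - c) * s i (s t G)
      ≈⟨ +-cong (-‿cong₂ (∂-quotient i f) eq₂) eq₁₂ ⟩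
    (f - s i f) - (s t f - s t (s i f)) + (s i (s t f) - s i (s t (s i f)))
      ≈⟨ solve 6 (λ a b c d e f → (a :- b) :- (c :- d) :+ (e :- f)
           := a :- b :- c :+ d :+ e :- f) ≈-refl f _ _ _ _ _ ⟩
    alt ∎
    where
    G = ∂ i f
    F = ∂ t G
    eq₂ : (a - c) * s t G ≈ s t f - s t (s i f)
    eq₂ = ≈-trans (*-congʳ (-‿cong₂ (≈-sym (s-below ℕ.≤-refl)) (≈-sym (s-lower t))))
                  (s-cong t (∂-quotient i f))
    eq₁₂ : (b - c) * s i (s t G) ≈ s i (s t f) - s i (s t (s i f))
    eq₁₂ = ≈-trans (*-congʳ (-‿cong₂ (≈-sym (s-lower i)) (≈-sym (s-above ℕ.≤-refl)))) (s-cong i eq₂)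

  right : (a - c) * ((b - c) * ((a - b) * ∂ t (∂ i (∂ t f)))) ≈ alt
  right = begin
    (a - c) * ((b - c) * ((a - b) * ∂ t K))
      ≈⟨ *-congˡ (solve 3 (λ a b c → a :* (b :* c) := b :* (a :* c)) ≈-refl (b - c) (a - b) (∂ t K)) ⟩
    (a - c) * ((a - b) * ((b - c) * ∂ t K))
      ≈⟨ *-congˡ (*-congˡ (∂-quotient t K)) ⟩
    (a - c) * ((a - b) * (K - s t K))
      ≈⟨ solve 5 (λ a b c F F′ → (a :- c) :* ((a :- b) :* (F :- F′))
           := (a :- c) :* ((a :- b) :* F) :- (a :- b) :* ((a :- c) :* F′)) ≈-refl a b c K (s t K) ⟩
    (a - c) * ((a - b) * K) - (a - b) * ((a - c) * s t K)
      ≈⟨ -‿cong₂ (*-congˡ (∂-quotient i H)) (*-congˡ (≈-trans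
           (*-congʳ (-‿cong₂ (≈-sym (s-below ℕ.≤-refl)) (≈-sym (s-lower t))))
           (≈-trans (s-cong t (∂-quotient i H)) (-‿cong₂ (s∂≈∂ t f) ≈-refl)))) ⟩
    (a - c) * (H - s i H) - (a - b) * (H - s t (s i H))
      ≈⟨ solve 6 (λ a b c G G₂ G₁₂ → (a :- c) :* (G :- G₂) :- (a :- b) :* (G :- G₁₂)
           := (b :- c) :* G :- (a :- c) :* G₂ :+ (a :- b) :* G₁₂) ≈-refl a b c H _ _ ⟩
    (b - c) * H - (a - c) * s i H + (a - b) * s t (s i H)
      ≈⟨ +-cong (-‿cong₂ (∂-quotient t f) eq₁) eq₂₁ ⟩
    (f - s t f) - (s i f - s i (s t f)) + (s t (s i f) - s t (s i (s t f)))
      ≈⟨ +-congˡ (-‿cong₂ ≈-refl (reflexive (≡.sym (s-braid i f)))) ⟩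
    (f - s t f) - (s i f - s i (s t f)) + (s t (s i f) - s i (s t (s i f)))
      ≈⟨ solve 6 (λ a b c d e f → (a :- c) :- (b :- e) :+ (d :- f)
           := a :- b :- c :+ d :+ e :- f) ≈-refl f _ _ _ _ _ ⟩
    alt ∎
    where
    H = ∂ t f
    K = ∂ i H
    eq₁ : (a - c) * s i H ≈ s i f - s i (s t f)
    eq₁ = ≈-trans (*-congʳ (-‿cong₂ (≈-sym (s-upper i)) (≈-sym (s-above ℕ.≤-refl))))
                  (s-cong i (∂-quotient t f))
    eq₂₁ : (a - b) * s t (s i H) ≈ s t (s i f) - s t (s i (s t f))
    eq₂₁ = ≈-trans (*-congʳ (-‿cong₂ (≈-sym (s-below ℕ.≤-refl)) (≈-sym (s-upper t)))) (s-cong t eq₁)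

∂-upper : ∀ i f → ∂ i (x (suc i) * f) ≈ x i * ∂ i f - f
∂-upper i f = begin
  con (∂-var i (suc i)) * f + s i (x (suc i)) * ∂ i f
    ≈⟨ +-cong (*-congʳ (reflexive (cong con (∂-var-upper i)))) (*-congʳ (s-upper i)) ⟩
  con (ℤ.- (+ 1)) * f + x i * ∂ i f
    ≈⟨ solve 2 (λ f g → con (ℤ.- (+ 1)) :* f :+ g := g :- f) ≈-refl f (x i * ∂ i f) ⟩
  x i * ∂ i f - f ∎

∂-lower : ∀ i f → ∂ i (x i * f) ≈ f + x (suc i) * ∂ i f
∂-lower i f = begin
  ∂ i (x i * f)
    ≈⟨ ∂-cong i (solve 3 (λ a b f → a :* f := (a :+ b) :* f :- b :* f) ≈-refl (x i) (x (suc i)) f) ⟩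
  ∂ i ((x i + x (suc i)) * f) - ∂ i (x (suc i) * f)
    ≈⟨ -‿cong₂ (∂-*-invariant (≈-trans (+-cong (s-lower i) (s-upper i)) (+-comm _ _)) f) (∂-upper i f) ⟩
  (x i + x (suc i)) * ∂ i f - (x i * ∂ i f - f)
    ≈⟨ solve 4 (λ a b f d → (a :+ b) :* d :- (a :* d :- f) := f :+ b :* d) ≈-refl (x i) (x (suc i)) f (∂ i f) ⟩
  f + x (suc i) * ∂ i f ∎

-- The 0-Hecke relations of θ, and the operators π

θ-+ : ∀ i f g → θ i (f + g) ≈ θ i f + θ i g
θ-+ i f g = *-distribˡ _ _ _

θ-neg : ∀ i f → θ i (- f) ≈ - θ i f
θ-neg i f = solve 2 (λ a b → a :* (:- b) := :- (a :* b)) ≈-refl _ _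

θ-0 : ∀ i → θ i 0# ≈ 0#
θ-0 i = zeroʳ _

θ-*-invariant : s i g ≈ g → ∀ f → θ i (g * f) ≈ g * θ i f
θ-*-invariant {i} {g} e f = ≈-trans (*-congˡ (∂-*-invariant e f))
  (solve 3 (λ a b c → a :* (b :* c) := b :* (a :* c)) ≈-refl _ g (∂ i f))

θ-invariant : s i g ≈ g → θ i g ≈ 0#
θ-invariant {i} e = ≈-trans (*-congˡ (∂-invariant e)) (θ-0 i)

θ-square : ∀ i f → θ i (θ i f) ≈ - θ i f
θ-square i f = begin
  x (suc i) * ∂ i (x (suc i) * ∂ i f)          ≈⟨ *-congˡ (∂-upper i (∂ i f)) ⟩
  x (suc i) * (x i * ∂ i (∂ i f) - ∂ i f)      ≈⟨ *-congˡ (-‿cong₂ (*-congˡ (∂∂≈0 i f)) ≈-refl) ⟩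
  x (suc i) * (x i * 0# - ∂ i f)
    ≈⟨ solve 3 (λ a b c → a :* (b :* con (+ 0) :- c) := :- (a :* c)) ≈-refl (x (suc i)) (x i) (∂ i f) ⟩
  - (x (suc i) * ∂ i f) ∎

θ-comm : suc i < j → ∀ f → θ i (θ j f) ≈ θ j (θ i f)
θ-comm {i} {j} i<j f = begin
  θ i (x (suc j) * ∂ j f)                 ≈⟨ θ-*-invariant (s-above (ℕ.m<n⇒m<1+n i<j)) (∂ j f) ⟩
  x (suc j) * (x (suc i) * ∂ i (∂ j f))   ≈⟨ *-congˡ (*-congˡ (∂-comm i<j f)) ⟩
  x (suc j) * (x (suc i) * ∂ j (∂ i f))   ≈⟨ *-congˡ (∂-*-invariant (s-below i<j) (∂ i f)) ⟨
  θ j (x (suc i) * ∂ i f)                 ∎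

-- Each side is x_{i+1} x_{i+2}² times the corresponding triple product of divided differences, so
-- `∂-braid` carries over. On the left the extra term of `∂-lower` dies by `∂∂≈0`.
θ-braid : ∀ i f → θ i (θ (suc i) (θ i f)) ≈ θ (suc i) (θ i (θ (suc i) f))
θ-braid i f = begin
  b * ∂ i (c * ∂ t (b * ∂ i f))
    ≈⟨ *-congˡ (∂-*-invariant (s-above ℕ.≤-refl) _) ⟩
  b * (c * ∂ i (∂ t (b * ∂ i f)))
    ≈⟨ *-congˡ (*-congˡ (∂-cong i (∂-lower t (∂ i f)))) ⟩
  b * (c * (∂ i (∂ i f) + ∂ i (c * ∂ t (∂ i f))))
    ≈⟨ *-congˡ (*-congˡ (+-cong (∂∂≈0 i f) (∂-*-invariant (s-above ℕ.≤-refl) _))) ⟩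
  b * (c * (0# + c * ∂ i (∂ t (∂ i f))))
    ≈⟨ *-congˡ (*-congˡ (+-congˡ (*-congˡ (∂-braid i f)))) ⟩
  b * (c * (0# + c * ∂ t (∂ i (∂ t f))))
    ≈⟨ solve 3 (λ b c h → b :* (c :* (con (+ 0) :+ c :* h)) := c :* ((c :* b) :* h)) ≈-refl b c _ ⟩
  c * ((c * b) * ∂ t (∂ i (∂ t f)))
    ≈⟨ *-congˡ (∂-*-invariant {g = c * b} (≈-trans (*-cong (s-upper t) (s-lower t)) (*-comm b c)) _) ⟨
  c * ∂ t ((c * b) * ∂ i (∂ t f))
    ≈⟨ *-congˡ (∂-cong t (solve 3 (λ b c h → (c :* b) :* h := b :* (c :* h)) ≈-refl b c _)) ⟩
  c * ∂ t (b * (c * ∂ i (∂ t f)))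
    ≈⟨ θ-cong t {b * ∂ i (c * ∂ t f)} (*-congˡ {b} (∂-*-invariant (s-above ℕ.≤-refl) _)) ⟨
  c * ∂ t (b * ∂ i (c * ∂ t f)) ∎
  where
  t = suc i
  b = x t
  c = x (suc t)

π : ℕ → P → P
π i f = f + θ i f

π-cong : ∀ i → f ≈ g → π i f ≈ π i g
π-cong i e = +-cong e (θ-cong i e)

π-*-invariant : s i g ≈ g → ∀ f → π i (g * f) ≈ g * π i f
π-*-invariant e f = ≈-trans (+-congˡ (θ-*-invariant e f)) (≈-sym (*-distribˡ _ _ _))

x*θ : ∀ i f → x i * θ i f ≈ π i (x (suc i) * f)
x*θ i f = begin
  x i * (x (suc i) * ∂ i f)
    ≈⟨ solve 4 (λ a b f d → a :* (b :* d) := b :* f :+ b :* (a :* d :- f)) ≈-refl (x i) (x (suc i)) f (∂ i f) ⟩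
  x (suc i) * f + x (suc i) * (x i * ∂ i f - f)
    ≈⟨ +-congˡ (*-congˡ (∂-upper i f)) ⟨
  π i (x (suc i) * f) ∎

-- Products of θ along cycles and Lehmer codes

private
  variable
    a b : ℕ

-- This is θ_w for the cycle w = s_p ⋯ s_{p+q-1}, which carries position p+q to p and moves each of
-- p, ..., p+q-1 up by one.
cyc : ℕ → ℕ → P → P
cyc p zero    f = f
cyc p (suc q) f = θ p (cyc (suc p) q f)

cyc-cong : ∀ p q → f ≈ g → cyc p q f ≈ cyc p q g
cyc-cong p zero    e = e
cyc-cong p (suc q) e = θ-cong p (cyc-cong (suc p) q e)

cyc-+ : ∀ p q f g → cyc p q (f + g) ≈ cyc p q f + cyc p q g
cyc-+ p zero    f g = ≈-refl
cyc-+ p (suc q) f g = ≈-trans (θ-cong p (cyc-+ (suc p) q f g)) (θ-+ p _ _)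

cyc-neg : ∀ p q f → cyc p q (- f) ≈ - cyc p q f
cyc-neg p zero    f = ≈-refl
cyc-neg p (suc q) f = ≈-trans (θ-cong p (cyc-neg (suc p) q f)) (θ-neg p _)

cyc-0 : ∀ p q → cyc p q 0# ≈ 0#
cyc-0 p zero    = ≈-refl
cyc-0 p (suc q) = ≈-trans (θ-cong p (cyc-0 (suc p) q)) (θ-0 p)

cyc-*-invariant : ∀ p q → (∀ {i} → p ≤ i → i < p ℕ.+ q → s i g ≈ g) →
                  ∀ f → cyc p q (g * f) ≈ g * cyc p q f
cyc-*-invariant p zero    inv f = ≈-refl
cyc-*-invariant p (suc q) inv f rewrite ℕ.+-suc p q =
  ≈-trans (θ-cong p (cyc-*-invariant (suc p) q (λ p<i i< → inv (ℕ.<⇒≤ p<i) i<) f))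
          (θ-*-invariant (inv ℕ.≤-refl (s≤s (ℕ.m≤m+n p q))) _)

cyc-snoc : ∀ p q f → cyc p (suc q) f ≈ cyc p q (θ (p ℕ.+ q) f)
cyc-snoc p zero    f rewrite ℕ.+-identityʳ p = ≈-refl
cyc-snoc p (suc q) f rewrite ℕ.+-suc p q = θ-cong p (cyc-snoc (suc p) q f)

cyc-θ-below : ∀ q → suc i < p → ∀ f → cyc p q (θ i f) ≈ θ i (cyc p q f)
cyc-θ-below zero    i<p f = ≈-refl
cyc-θ-below (suc q) i<p f =
  ≈-trans (θ-cong _ (cyc-θ-below q (ℕ.m<n⇒m<1+n i<p) f)) (≈-sym (θ-comm i<p _))

cyc-θ-above : ∀ p q → p ℕ.+ q < i → ∀ f → cyc p q (θ i f) ≈ θ i (cyc p q f)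
cyc-θ-above p zero    p<i f = ≈-refl
cyc-θ-above p (suc q) p<i f rewrite ℕ.+-suc p q =
  ≈-trans (θ-cong p (cyc-θ-above (suc p) q p<i f))
          (θ-comm (ℕ.≤-<-trans (s≤s (ℕ.m≤m+n p q)) p<i) _)

-- Mirrors w s_i = s_{i+1} w for the cycle w: `θ i` moves left through commuting factors until it
-- meets θ_i θ_{i+1}, where one braid move turns it into `θ (suc i)`, which commutes with the
-- factors that are left.
cyc-θ-inside : ∀ p q → p ≤ i → suc i < p ℕ.+ q → ∀ f →
               cyc p q (θ i f) ≈ θ (suc i) (cyc p q f)
cyc-θ-inside p zero p≤i i<p f rewrite ℕ.+-identityʳ p =
  contradiction p≤i (ℕ.<⇒≱ (ℕ.<-trans (ℕ.n<1+n _) i<p))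
cyc-θ-inside p (suc q) p≤i i< f rewrite ℕ.+-suc p q with ℕ.m≤n⇒m<n∨m≡n p≤i
... | inj₁ p<i =
  ≈-trans (θ-cong p (cyc-θ-inside (suc p) q p<i i< f)) (θ-comm (s≤s p<i) _)
... | inj₂ ≡.refl with q
...   | zero   rewrite ℕ.+-identityʳ p = contradiction i< (ℕ.n≮n _)
...   | suc q′ =
  ≈-trans (θ-cong p (θ-cong (suc p) (cyc-θ-below q′ ℕ.≤-refl f))) (θ-braid p _)

cyc-cyc-inside : ∀ p q r m → p ≤ r → r ℕ.+ m < p ℕ.+ q → ∀ f →
                 cyc p q (cyc r m f) ≈ cyc (suc r) m (cyc p q f)
cyc-cyc-inside p q r zero    p≤r r< f = ≈-refl
cyc-cyc-inside p q r (suc m) p≤r r< f rewrite ℕ.+-suc r m =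
  ≈-trans (cyc-θ-inside p q p≤r (ℕ.≤-<-trans (s≤s (ℕ.m≤m+n r m)) r<) _)
          (θ-cong (suc r) (cyc-cyc-inside p q (suc r) m (ℕ.m≤n⇒m≤1+n p≤r) r< f))

-- Θ 0 c is θ_w for the permutation w with Lehmer code c.
Θ : ℕ → Vec ℕ n → P → P
Θ p []      f = f
Θ p (q ∷ c) f = Θ (suc p) c (cyc p q f)

data IsCode : Vec ℕ n → Set where
  []  : IsCode []
  _∷_ : {c : Vec ℕ n} → q ≤ n → IsCode c → IsCode (q ∷ c)

Θ-cong : ∀ p (c : Vec ℕ n) → f ≈ g → Θ p c f ≈ Θ p c g
Θ-cong p []      e = e
Θ-cong p (q ∷ c) e = Θ-cong (suc p) c (cyc-cong p q e)

Θ-+ : ∀ p (c : Vec ℕ n) f g → Θ p c (f + g) ≈ Θ p c f + Θ p c g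
Θ-+ p []      f g = ≈-refl
Θ-+ p (q ∷ c) f g = ≈-trans (Θ-cong (suc p) c (cyc-+ p q f g)) (Θ-+ (suc p) c _ _)

Θ-neg : ∀ p (c : Vec ℕ n) f → Θ p c (- f) ≈ - Θ p c f
Θ-neg p []      f = ≈-refl
Θ-neg p (q ∷ c) f = ≈-trans (Θ-cong (suc p) c (cyc-neg p q f)) (Θ-neg (suc p) c _)

Θ-0 : ∀ p (c : Vec ℕ n) → Θ p c 0# ≈ 0#
Θ-0 p []      = ≈-refl
Θ-0 p (q ∷ c) = ≈-trans (Θ-cong (suc p) c (cyc-0 p q)) (Θ-0 (suc p) c)

Θ-θ-below : (c : Vec ℕ n) → suc i < p → ∀ f → Θ p c (θ i f) ≈ θ i (Θ p c f)
Θ-θ-below []      i<p f = ≈-refl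
Θ-θ-below (q ∷ c) i<p f =
  ≈-trans (Θ-cong _ c (cyc-θ-below q i<p f)) (Θ-θ-below c (ℕ.m<n⇒m<1+n i<p) _)

Θ-*-invariant : ∀ p (c : Vec ℕ n) → (∀ {i} → p ≤ i → s i g ≈ g) →
                ∀ f → Θ p c (g * f) ≈ g * Θ p c f
Θ-*-invariant p []      inv f = ≈-refl
Θ-*-invariant p (q ∷ c) inv f =
  ≈-trans (Θ-cong (suc p) c (cyc-*-invariant p q (λ p≤i _ → inv p≤i) f))
          (Θ-*-invariant (suc p) c (λ p<i → inv (ℕ.<⇒≤ p<i)) _)

-- Right multiplication of w by s_i either lengthens w, giving the new code `d`, or shortens it,
-- giving the sign. The position of `i` relative to the end `p + q` of the first cycle decides:
-- beyond it, `θ i` passes unchanged to the tail; at it, the cycle grows by one factor; one before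
-- it, the last factor is repeated and `θ-square` applies; earlier still, `θ (suc i)` reaches the
-- tail.
Θ-θ : ∀ p {c : Vec ℕ n} → IsCode c → p ≤ i → suc i < p ℕ.+ n →
      (Σ[ d ∈ Vec ℕ n ] IsCode d × ∀ f → Θ p c (θ i f) ≈ Θ p d f)
      ⊎ (∀ f → Θ p c (θ i f) ≈ - Θ p c f)
Θ-θ p [] p≤i i< rewrite ℕ.+-identityʳ p =
  contradiction p≤i (ℕ.<⇒≱ (ℕ.<-trans (ℕ.n<1+n _) i<))
Θ-θ {suc n} {i} p {q ∷ c} (q≤n ∷ isC) p≤i i< with ℕ.<-cmp i (p ℕ.+ q)
... | tri> _ _ p+q<i rewrite ℕ.+-suc p n
  with Θ-θ (suc p) isC (ℕ.≤-<-trans (ℕ.m≤m+n p q) p+q<i) i<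
...   | inj₁ (d , isD , e) = inj₁ (q ∷ d , q≤n ∷ isD , λ f →
          ≈-trans (Θ-cong (suc p) c (cyc-θ-above p q p+q<i f)) (e _))
...   | inj₂ e = inj₂ λ f →
          ≈-trans (Θ-cong (suc p) c (cyc-θ-above p q p+q<i f)) (e _)
Θ-θ {suc n} {i} p {q ∷ c} (q≤n ∷ isC) p≤i i< | tri≈ _ ≡.refl _ =
  inj₁ (suc q ∷ c
       , ℕ.+-cancelˡ-< p q n (ℕ.≤-pred (≡.subst (suc (p ℕ.+ q) <_) (ℕ.+-suc p n) i<)) ∷ isC
       , λ f → Θ-cong (suc p) c (≈-sym (cyc-snoc p q f)))
Θ-θ {suc n} {i} p {q ∷ c} (q≤n ∷ isC) p≤i i< | tri< i<p+q _ _
  with ℕ.m≤n⇒m<n∨m≡n i<p+q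
... | inj₁ si<p+q rewrite ℕ.+-suc p n
  with Θ-θ (suc p) isC (s≤s p≤i) (s≤s (ℕ.<-≤-trans si<p+q (ℕ.+-monoʳ-≤ p q≤n)))
...   | inj₁ (d , isD , e) = inj₁ (q ∷ d , q≤n ∷ isD , λ f →
          ≈-trans (Θ-cong (suc p) c (cyc-θ-inside p q p≤i si<p+q f)) (e _))
...   | inj₂ e = inj₂ λ f →
          ≈-trans (Θ-cong (suc p) c (cyc-θ-inside p q p≤i si<p+q f)) (e _)
Θ-θ {suc n} {i} p {zero ∷ c} (q≤n ∷ isC) p≤i i< | tri< i<p+q _ _ | inj₂ e
  rewrite ℕ.+-identityʳ p = contradiction p≤i (ℕ.<⇒≱ i<p+q)
Θ-θ {suc n} {i} p {suc q ∷ c} (q≤n ∷ isC) p≤i i< | tri< i<p+q _ _ | inj₂ e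
  with ≡.trans e (ℕ.+-suc p q)
... | ≡.refl = inj₂ λ f → ≈-trans (Θ-cong (suc p) c (begin
        cyc p (suc q) (θ (p ℕ.+ q) f)              ≈⟨ cyc-snoc p q _ ⟩
        cyc p q (θ (p ℕ.+ q) (θ (p ℕ.+ q) f))      ≈⟨ cyc-cong p q (θ-square (p ℕ.+ q) f) ⟩
        cyc p q (- θ (p ℕ.+ q) f)                  ≈⟨ cyc-neg p q _ ⟩
        - cyc p q (θ (p ℕ.+ q) f)                  ≈⟨ neg-cong (cyc-snoc p q f) ⟨
        - cyc p (suc q) f ∎)) (Θ-neg (suc p) c _)

-- Nonnegative sums of the operators θ_y

-- Coefficients are encoded by repeating a code. Every constructor carries a pointwise equation,
-- since composites such as `λ f → F (π i f)` agree with a sum only up to `_≈_`.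
data Cone (n : ℕ) : (P → P) → Set where
  zero : ∀ {F} → (∀ f → F f ≈ 0#) → Cone n F
  add  : ∀ {F G} (c : Vec ℕ n) → IsCode c → Cone n G → (∀ f → F f ≈ Θ 0 c f + G f) → Cone n F

Cone-resp : ∀ {F G} → (∀ f → G f ≈ F f) → Cone n F → Cone n G
Cone-resp e (zero e′)        = zero λ f → ≈-trans (e f) (e′ f)
Cone-resp e (add c isC C e′) = add c isC C λ f → ≈-trans (e f) (e′ f)

Cone-Θ : {c : Vec ℕ n} → IsCode c → Cone n (Θ 0 c)
Cone-Θ {c = c} isC = add c isC (zero λ f → ≈-refl) λ f → ≈-sym (+-identityʳ _)

Cone-π : ∀ {F} → suc i < n → Cone n F → Cone n (λ f → F (π i f))
Cone-π i<n (zero e) = zero λ f → e _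
Cone-π {i} {n} i<n (add {F} {G} c isC C e) with Θ-θ 0 isC z≤n i<n
... | inj₂ neg = Cone-resp (λ f → begin
    F (π i f)                                       ≈⟨ e _ ⟩
    Θ 0 c (f + θ i f) + G (π i f)                   ≈⟨ +-cong (Θ-+ 0 c f _) ≈-refl ⟩
    Θ 0 c f + Θ 0 c (θ i f) + G (π i f)             ≈⟨ +-cong (+-congˡ (neg f)) ≈-refl ⟩
    Θ 0 c f - Θ 0 c f + G (π i f)
      ≈⟨ solve 2 (λ a b → a :- a :+ b := b) ≈-refl _ _ ⟩
    G (π i f)                                       ∎) (Cone-π i<n C)
... | inj₁ (d , isD , e′) = add c isC (add d isD (Cone-π i<n C) λ f → ≈-refl) λ f → begin
    F (π i f)                                       ≈⟨ e _ ⟩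
    Θ 0 c (f + θ i f) + G (π i f)                   ≈⟨ +-cong (Θ-+ 0 c f _) ≈-refl ⟩
    Θ 0 c f + Θ 0 c (θ i f) + G (π i f)             ≈⟨ +-cong (+-congˡ (e′ f)) ≈-refl ⟩
    Θ 0 c f + Θ 0 d f + G (π i f)                   ≈⟨ +-assoc _ _ _ ⟩
    Θ 0 c f + (Θ 0 d f + G (π i f))                 ∎

cycΠ : ℕ → ℕ → P → P
cycΠ p zero    f = f
cycΠ p (suc q) f = π p (cycΠ (suc p) q f)

Π : ℕ → Vec ℕ n → P → P
Π p []      f = f
Π p (q ∷ c) f = Π (suc p) c (cycΠ p q f)

cycΠ-cong : ∀ p q → f ≈ g → cycΠ p q f ≈ cycΠ p q g
cycΠ-cong p zero    e = e
cycΠ-cong p (suc q) e = π-cong p (cycΠ-cong (suc p) q e)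

Π-cong : ∀ p (c : Vec ℕ n) → f ≈ g → Π p c f ≈ Π p c g
Π-cong p []      e = e
Π-cong p (q ∷ c) e = Π-cong (suc p) c (cycΠ-cong p q e)

cycΠ-*-invariant : ∀ p q → (∀ {i} → p ≤ i → s i g ≈ g) →
                   ∀ f → cycΠ p q (g * f) ≈ g * cycΠ p q f
cycΠ-*-invariant p zero    inv f = ≈-refl
cycΠ-*-invariant p (suc q) inv f =
  ≈-trans (π-cong p (cycΠ-*-invariant (suc p) q (λ p<i → inv (ℕ.<⇒≤ p<i)) f))
          (π-*-invariant (inv ℕ.≤-refl) _)

Π-*-invariant : ∀ p (c : Vec ℕ n) → (∀ {i} → p ≤ i → s i g ≈ g) →
                ∀ f → Π p c (g * f) ≈ g * Π p c f
Π-*-invariant p []      inv f = ≈-refl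
Π-*-invariant p (q ∷ c) inv f =
  ≈-trans (Π-cong (suc p) c (cycΠ-*-invariant p q inv f))
          (Π-*-invariant (suc p) c (λ p<i → inv (ℕ.<⇒≤ p<i)) _)

Cone-cycΠ : ∀ {F} p q → p ℕ.+ q < n → Cone n F → Cone n (λ f → F (cycΠ p q f))
Cone-cycΠ p zero    p< C = C
Cone-cycΠ p (suc q) p< C rewrite ℕ.+-suc p q =
  Cone-cycΠ (suc p) q p< (Cone-π (ℕ.≤-<-trans (s≤s (ℕ.m≤m+n p q)) p<) C)

Cone-Π : ∀ {m F} p {c : Vec ℕ m} → IsCode c → p ℕ.+ m ≡ n → Cone n F →
         Cone n (λ f → F (Π p c f))
Cone-Π p []                              e C = C
Cone-Π {m = suc m} p {q ∷ c} (q≤m ∷ isC) e C =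
  Cone-cycΠ p q
    (≡.subst (p ℕ.+ q <_) (≡.trans (≡.sym (ℕ.+-suc p m)) e) (s≤s (ℕ.+-monoʳ-≤ p q≤m)))
    (Cone-Π (suc p) isC (≡.trans (≡.sym (ℕ.+-suc p m)) e) C)

-- Sorting, and codes of weak compositions

above-yes : ∀ (γ : Vec ℕ n) → a < b → above a (b ∷ γ) ≡ suc (above a γ)
above-yes {a = a} {b} γ a<b with a ℕ.<? b
... | yes _   = ≡.refl
... | no  a≮b = contradiction a<b a≮b

above-no : ∀ (γ : Vec ℕ n) → b ≤ a → above a (b ∷ γ) ≡ above a γ
above-no {b = b} {a} γ b≤a with a ℕ.<? b
... | yes a<b = contradiction a<b (ℕ.≤⇒≯ b≤a)
... | no  _   = ≡.refl

above-antitone : ∀ (γ : Vec ℕ n) → a ≤ b → above b γ ≤ above a γ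
above-antitone []      a≤b = z≤n
above-antitone {a = a} {b} (c ∷ γ) a≤b with b ℕ.<? c | a ℕ.<? c
... | yes _   | yes _   = s≤s (above-antitone γ a≤b)
... | yes b<c | no  a≮c = contradiction (ℕ.≤-<-trans a≤b b<c) a≮c
... | no  _   | yes _   = ℕ.m≤n⇒m≤1+n (above-antitone γ a≤b)
... | no  _   | no  _   = above-antitone γ a≤b

above≤n : ∀ a (γ : Vec ℕ n) → above a γ ≤ n
above≤n a []      = z≤n
above≤n a (b ∷ γ) = ℕ.≤-trans (above-≤ a b γ) (s≤s (above≤n a γ))

above-++ : ∀ a (β : Vec ℕ k) (δ : Vec ℕ m) → above a (β ++ δ) ≡ above a β ℕ.+ above a δ
above-++ a []      δ = ≡.refl
above-++ a (b ∷ β) δ with a ℕ.<? b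
... | yes _ = cong suc (above-++ a β δ)
... | no  _ = above-++ a β δ

above-sort : ∀ a (γ : Vec ℕ n) → above a (sort γ) ≡ above a γ
above-sort a γ = ≡.trans (≡.sym (above-swaps a (sort-word γ) (sort γ))) (cong (above a) (swaps-sort γ))

above-insert : ∀ a b (β : Vec ℕ k) (δ : Vec ℕ m) → above b (insert a β ++ δ) ≡ above b (a ∷ β ++ δ)
above-insert a b []      δ = ≡.refl
above-insert a b (c ∷ β) δ with a ℕ.<? c
... | no _  = ≡.refl
... | yes _ with b ℕ.<? c in b<c | b ℕ.<? a | above-insert a b β δ
...   | yes _ | yes _ | e rewrite b<c = cong suc e
...   | yes _ | no  _ | e rewrite b<c = cong suc e
...   | no  _ | yes _ | e rewrite b<c = e
...   | no  _ | no  _ | e rewrite b<c = e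

insert-comm : ∀ a b (γ : Vec ℕ n) → insert a (insert b γ) ≡ insert b (insert a γ)
insert-comm a b [] with a ℕ.<? b | b ℕ.<? a
... | yes a<b | yes b<a = contradiction a<b (ℕ.<-asym b<a)
... | yes _   | no  _   = ≡.refl
... | no  _   | yes _   = ≡.refl
... | no  a≮b | no  b≮a with ℕ.≤-antisym (ℕ.≮⇒≥ a≮b) (ℕ.≮⇒≥ b≮a)
...   | ≡.refl = ≡.refl
insert-comm a b (c ∷ γ) with a ℕ.<? c in a<?c | b ℕ.<? c in b<?c
... | yes _ | yes _ rewrite a<?c | b<?c = cong (c ∷_) (insert-comm a b γ)
... | yes a<c | no b≮c with a ℕ.<? b
...   | yes _   rewrite a<?c | b<?c = ≡.refl
...   | no  a≮b = contradiction (ℕ.<-≤-trans a<c (ℕ.≮⇒≥ b≮c)) a≮b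
insert-comm a b (c ∷ γ) | no a≮c | yes b<c with b ℕ.<? a
...   | yes _   rewrite a<?c | b<?c = ≡.refl
...   | no  b≮a = contradiction (ℕ.<-≤-trans b<c (ℕ.≮⇒≥ a≮c)) b≮a
insert-comm a b (c ∷ γ) | no a≮c | no b≮c with a ℕ.<? b | b ℕ.<? a
... | yes a<b | yes b<a = contradiction a<b (ℕ.<-asym b<a)
... | yes _   | no  _   rewrite a<?c = ≡.refl
... | no  _   | yes _   rewrite b<?c = ≡.refl
... | no  a≮b | no  b≮a with ℕ.≤-antisym (ℕ.≮⇒≥ a≮b) (ℕ.≮⇒≥ b≮a)
...   | ≡.refl = ≡.refl

insert-head : ∀ {γ : Vec ℕ n} → IsPartition (a ∷ γ) → insert a γ ≡ a ∷ γ
insert-head [-] = ≡.refl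
insert-head {a = a} {γ = b ∷ γ} (a≥b ∷ _) with a ℕ.<? b
... | yes a<b = contradiction a<b (ℕ.≤⇒≯ a≥b)
... | no  _   = ≡.refl

sort-fixes-partition : ∀ {γ : Vec ℕ n} → IsPartition γ → sort γ ≡ γ
sort-fixes-partition {γ = []}    P = ≡.refl
sort-fixes-partition {γ = a ∷ γ} P =
  ≡.trans (cong (insert a) (sort-fixes-partition (Linked.tail P))) (insert-head P)

sort-insert : ∀ a (β : Vec ℕ k) (δ : Vec ℕ m) → sort (insert a β ++ δ) ≡ sort (a ∷ β ++ δ)
sort-insert a []      δ = ≡.refl
sort-insert a (b ∷ β) δ with a ℕ.<? b
... | no  _ = ≡.refl
... | yes _ = ≡.trans (cong (insert b) (sort-insert a β δ)) (insert-comm b a (sort (β ++ δ)))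

sort-blocks : ∀ (β : Vec ℕ k) (δ : Vec ℕ m) → sort (sort β ++ sort δ) ≡ sort (β ++ δ)
sort-blocks []      δ = sort-fixes-partition (sort-partition δ)
sort-blocks (a ∷ β) δ =
  ≡.trans (sort-insert a (sort β) (sort δ)) (cong (insert a) (sort-blocks β δ))

-- The Lehmer code of the shortest w with `w · sort γ ≡ γ`; its entries add up to `inversions γ`.
code : Vec ℕ n → Vec ℕ n
code []      = []
code (a ∷ γ) = above a γ ∷ code γ

isCode : (γ : Vec ℕ n) → IsCode (code γ)
isCode []      = []
isCode (a ∷ γ) = above≤n a γ ∷ isCode γ

isCode-++ : {c : Vec ℕ k} {d : Vec ℕ m} → IsCode c → IsCode d → IsCode (c ++ d)
isCode-++ []            isD = isD
isCode-++ (q≤ ∷ isC) isD = ℕ.≤-trans q≤ (ℕ.m≤m+n _ _) ∷ isCode-++ isC isD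

Θ-code-partition : ∀ p {γ : Vec ℕ n} → IsPartition γ → ∀ f → Θ p (code γ) f ≡ f
Θ-code-partition p {[]}    P f = ≡.refl
Θ-code-partition p {a ∷ γ} P f rewrite above-partition {γ = γ} (ℕ.≤-refl {a}) P =
  Θ-code-partition (suc p) (Linked.tail P) f

Π-code-partition : ∀ p {γ : Vec ℕ n} → IsPartition γ → ∀ f → Π p (code γ) f ≡ f
Π-code-partition p {[]}    P f = ≡.refl
Π-code-partition p {a ∷ γ} P f rewrite above-partition {γ = γ} (ℕ.≤-refl {a}) P =
  Π-code-partition (suc p) (Linked.tail P) f

θ-word-from : ℕ → Word n → P → P
θ-word-from p is f = foldr (λ i → θ (p ℕ.+ toℕ (lower i))) f is

θ-word-from-suc : ∀ p (is : Word n) f → θ-word-from p (List.map suc is) f ≡ θ-word-from (suc p) is f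
θ-word-from-suc p []       f = ≡.refl
θ-word-from-suc p (i ∷ is) f = cong₂ θ (ℕ.+-suc p (toℕ (lower i))) (θ-word-from-suc p is f)

θ-insert-word : ∀ p a {γ : Vec ℕ n} → IsPartition γ → ∀ f →
                θ-word-from p (insert-word a γ) f ≡ cyc p (above a γ) f
θ-insert-word p a {[]}    P f = ≡.refl
θ-insert-word p a {b ∷ γ} P f with a ℕ.<? b
... | yes _   = cong₂ θ (ℕ.+-identityʳ p)
                  (≡.trans (θ-word-from-suc p (insert-word a γ) f)
                           (θ-insert-word (suc p) a (Linked.tail P) f))
... | no  a≮b rewrite above-partition (ℕ.≮⇒≥ a≮b) P = ≡.refl

θ-sort-word : ∀ p (γ : Vec ℕ n) f → θ-word-from p (sort-word γ) f ≡ Θ p (code γ) f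
θ-sort-word p []      f = ≡.refl
θ-sort-word p (a ∷ γ) f =
  ≡.trans (List.foldr-++ _ f (List.map suc (sort-word γ)) (insert-word a (sort γ)))
  (≡.trans (θ-word-from-suc p (sort-word γ) _)
  (≡.trans (θ-sort-word (suc p) γ _)
  (cong (Θ (suc p) (code γ))
    (≡.trans (θ-insert-word p a (sort-partition γ) f)
             (cong (λ q → cyc p q f) (above-sort a γ))))))

-- The bridge from the reduced words recorded by `straighten` to codes; atoms are used below only in
-- this form.
𝒜≡Θ : (γ : Vec ℕ n) → 𝒜 γ ≡ Θ 0 (code γ) (x^ sort γ)
𝒜≡Θ γ = θ-sort-word 0 γ (x^ sort γ)

-- The factorization w = u v along two blocks

-- The codes start with A+1, B and with B, A, where B ≤ A. By `cyc-cyc-inside` the cycle of length B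
-- slides through the longer one, which leaves a single `θ p`; the later cycles start at p+2 and
-- commute with it.
Θ-code-swap : ∀ p (γ : Vec ℕ n) → a < b → ∀ f →
              Θ p (code (a ∷ b ∷ γ)) f ≈ θ p (Θ p (code (b ∷ a ∷ γ)) f)
Θ-code-swap {a = a} {b} p γ a<b f
  rewrite above-yes γ a<b | above-no γ (ℕ.<⇒≤ a<b) = begin
    Θ (2 ℕ.+ p) C (cyc (suc p) B (cyc p (suc A) f))
      ≈⟨ Θ-cong (2 ℕ.+ p) C (cyc-cyc-inside p (suc A) p B ℕ.≤-refl
           (ℕ.+-monoʳ-< p (s≤s (above-antitone γ (ℕ.<⇒≤ a<b)))) f) ⟨
    Θ (2 ℕ.+ p) C (θ p (cyc (suc p) A (cyc p B f)))
      ≈⟨ Θ-θ-below C ℕ.≤-refl _ ⟩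
    θ p (Θ (2 ℕ.+ p) C (cyc (suc p) A (cyc p B f))) ∎
  where
  A = above a γ
  B = above b γ
  C = code γ

-- Each entry of `β` larger than `a` is passed by one `Θ-code-swap`, and the resulting factors θ_p,
-- θ_{p+1}, ... form the cycle.
Θ-code-insert : ∀ p a {β : Vec ℕ k} (δ : Vec ℕ m) → IsPartition β → ∀ f →
                Θ p (code (a ∷ β ++ δ)) f ≈ cyc p (above a β) (Θ p (code (insert a β ++ δ)) f)
Θ-code-insert p a {[]}    δ P f = ≈-refl
Θ-code-insert p a {b ∷ β} δ P f with a ℕ.<? b
... | no  a≮b rewrite above-partition (ℕ.≮⇒≥ a≮b) P | above-no {a = a} (β ++ δ) (ℕ.≮⇒≥ a≮b) = ≈-refl
... | yes a<b
  rewrite above-insert a b β δ =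
  ≈-trans (reflexive (cong (λ q → Θ (suc p) (code (b ∷ β ++ δ)) (cyc p q f)) (≡.sym (above-yes (β ++ δ) a<b))))
  (≈-trans (Θ-code-swap p (β ++ δ) a<b f)
           (θ-cong p (Θ-code-insert (suc p) a δ (Linked.tail P) _)))

-- Here `code β ++ code δ` is the code of u, which rearranges each block separately, and the code of
-- the two sorted blocks is that of v. The cycle of each entry of `β` splits: the part crossing
-- larger entries of `β` goes to u, the part crossing larger entries of `δ` stays in v.
Θ-code-blocks : ∀ p (β : Vec ℕ k) (δ : Vec ℕ m) f →
                Θ p (code (β ++ δ)) f ≈ Θ p (code β ++ code δ) (Θ p (code (sort β ++ sort δ)) f)
Θ-code-blocks p []      δ f =
  Θ-cong p (code δ) (reflexive (≡.sym (Θ-code-partition p (sort-partition δ) f)))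
Θ-code-blocks p (a ∷ β) δ f = begin
  Θ (suc p) (code (β ++ δ)) (cyc p (above a (β ++ δ)) f)
    ≈⟨ Θ-code-blocks (suc p) β δ _ ⟩
  Θ (suc p) (code β ++ code δ) (Θ (suc p) (code (sort β ++ sort δ)) (cyc p (above a (β ++ δ)) f))
    ≈⟨ Θ-cong (suc p) (code β ++ code δ) (≈-trans
         (reflexive (cong (λ q → Θ (suc p) (code (sort β ++ sort δ)) (cyc p q f)) above-blocks))
         (≈-trans (Θ-code-insert p a (sort δ) (sort-partition β) f)
           (reflexive (cong (λ q → cyc p q (Θ p (code (sort (a ∷ β) ++ sort δ)) f)) (above-sort a β))))) ⟩
  Θ (suc p) (code β ++ code δ) (cyc p (above a β) (Θ p (code (sort (a ∷ β) ++ sort δ)) f)) ∎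
  where
  above-blocks : above a (β ++ δ) ≡ above a (sort β ++ sort δ)
  above-blocks = ≡.trans (above-++ a β δ)
    (≡.trans (≡.sym (cong₂ ℕ._+_ (above-sort a β) (above-sort a δ)))
             (≡.sym (above-++ a (sort β) (sort δ))))

-- Moving ω_k through θ_w

ω : ℕ → ℕ → P
ω p zero    = 1#
ω p (suc k) = x p * ω (suc p) k

ω-snoc : ∀ p k → ω p (suc k) ≈ ω p k * x (p ℕ.+ k)
ω-snoc p zero rewrite ℕ.+-identityʳ p = *-comm _ _
ω-snoc p (suc k) rewrite ℕ.+-suc p k = ≈-trans (*-congˡ (ω-snoc (suc p) k)) (≈-sym (*-assoc _ _ _))

s-ω-below : ∀ k → suc i < p → s i (ω p k) ≈ ω p k
s-ω-below zero    i<p = ≈-refl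
s-ω-below (suc k) i<p = *-cong (s-above i<p) (s-ω-below k (ℕ.m<n⇒m<1+n i<p))

s-ω : ∀ p k → p ≤ i → suc i < p ℕ.+ k → s i (ω p k) ≈ ω p k
s-ω p zero    p≤i i< = ≈-refl
s-ω p (suc k) p≤i i< rewrite ℕ.+-suc p k with ℕ.m≤n⇒m<n∨m≡n p≤i
... | inj₁ p<i = *-cong (s-below p<i) (s-ω (suc p) k p<i i<)
... | inj₂ ≡.refl with k
...   | zero   rewrite ℕ.+-identityʳ p = contradiction i< (ℕ.n≮n _)
...   | suc k′ = ≈-trans (*-cong (s-lower p) (*-cong (s-upper p) (s-ω-below k′ ℕ.≤-refl)))
                   (solve 3 (λ a b c → b :* (a :* c) := a :* (b :* c)) ≈-refl (x p) (x (suc p)) _)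

-- Since q ≤ k, the first cycle permutes only variables of `ω p (suc k)`, in which this product is
-- symmetric. All later operators fix `x p`, so it can be split off before the induction continues.
Θ-ω : ∀ p {c : Vec ℕ k} (d : Vec ℕ m) → IsCode c → ∀ f →
      Θ p (c ++ d) (ω p k * f) ≈ ω p k * Θ p (c ++ d) f
Θ-ω p d [] f = ≈-trans (Θ-cong p d (*-identityˡ f)) (≈-sym (*-identityˡ _))
Θ-ω {k = suc k} p {q ∷ c} d (q≤k ∷ isC) f = begin
  Θ (suc p) (c ++ d) (cyc p q (ω p (suc k) * f))
    ≈⟨ Θ-cong (suc p) (c ++ d) (≈-trans (cyc-*-invariant p q inv f) (*-assoc _ _ _)) ⟩
  Θ (suc p) (c ++ d) (x p * (ω (suc p) k * cyc p q f))
    ≈⟨ Θ-*-invariant (suc p) (c ++ d) s-below _ ⟩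
  x p * Θ (suc p) (c ++ d) (ω (suc p) k * cyc p q f)
    ≈⟨ *-congˡ (Θ-ω (suc p) d isC _) ⟩
  x p * (ω (suc p) k * Θ (suc p) (c ++ d) (cyc p q f))
    ≈⟨ *-assoc _ _ _ ⟨
  ω p (suc k) * Θ p ((q ∷ c) ++ d) f ∎
  where
  inv : ∀ {i} → p ≤ i → i < p ℕ.+ q → s i (ω p (suc k)) ≈ ω p (suc k)
  inv {i} p≤i i< = s-ω p (suc k) p≤i
    (≡.subst (suc i <_) (≡.sym (ℕ.+-suc p k)) (s≤s (ℕ.<-≤-trans i< (ℕ.+-monoʳ-≤ p q≤k))))

s-^ : ∀ a → s i g ≈ g → s i (g ^ a) ≈ g ^ a
s-^ zero    e = ≈-refl
s-^ (suc a) e = *-cong e (s-^ a e)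

s-monomial-below : (γ : Vec ℕ n) → suc i < p → s i (monomial p γ) ≈ monomial p γ
s-monomial-below []      i<p = ≈-refl
s-monomial-below (a ∷ γ) i<p = *-cong (s-^ a (s-above i<p)) (s-monomial-below γ (ℕ.m<n⇒m<1+n i<p))

infixl 6 _⊕_
_⊕_ : Vec ℕ n → Vec ℕ n → Vec ℕ n
_⊕_ = zipWith ℕ._+_

monomial-⊕ : ∀ p (ε γ : Vec ℕ n) → monomial p ε * monomial p γ ≈ monomial p (ε ⊕ γ)
monomial-⊕ p []      []      = *-identityʳ _
monomial-⊕ p (e ∷ ε) (a ∷ γ) = begin
  (x p ^ e * monomial (suc p) ε) * (x p ^ a * monomial (suc p) γ)
    ≈⟨ solve 4 (λ a b c d → (a :* b) :* (c :* d) := (a :* c) :* (b :* d)) ≈-refl _ _ _ _ ⟩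
  (x p ^ e * x p ^ a) * (monomial (suc p) ε * monomial (suc p) γ)
    ≈⟨ *-cong (≈-sym (^-homo-* (x p) e a)) (monomial-⊕ (suc p) ε γ) ⟩
  x p ^ (e ℕ.+ a) * monomial (suc p) (ε ⊕ γ) ∎

monomial-zeros : ∀ p m → monomial p (replicate m 0) ≈ 1#
monomial-zeros p zero    = ≈-refl
monomial-zeros p (suc m) = ≈-trans (*-congˡ (monomial-zeros (suc p) m)) (*-identityʳ _)

zeros-⊕ : (γ : Vec ℕ n) → replicate n 0 ⊕ γ ≡ γ
zeros-⊕ []      = ≡.refl
zeros-⊕ (a ∷ γ) = cong (a ∷_) (zeros-⊕ γ)

-- Unlike Data.Vec.insertAt, the position is a number and is cut off at n.
put : ℕ → ℕ → Vec ℕ n → Vec ℕ (suc n)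
put zero    a γ       = a ∷ γ
put (suc q) a []      = a ∷ []
put (suc q) a (b ∷ γ) = b ∷ put q a γ

data ZeroPrefix : ℕ → Vec ℕ n → Set where
  zero : {γ : Vec ℕ n} → ZeroPrefix 0 γ
  suc  : {γ : Vec ℕ n} → ZeroPrefix q γ → ZeroPrefix (suc q) (0 ∷ γ)

zeroPrefix-≤ : {γ : Vec ℕ n} → q ≤ r → ZeroPrefix r γ → ZeroPrefix q γ
zeroPrefix-≤ z≤n       z       = zero
zeroPrefix-≤ (s≤s q≤r) (suc z) = suc (zeroPrefix-≤ q≤r z)

zeroPrefix-replicate : q ≤ m → ZeroPrefix q (replicate m 0)
zeroPrefix-replicate z≤n       = zero
zeroPrefix-replicate (s≤s q≤m) = suc (zeroPrefix-replicate q≤m)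

zeroPrefix-put : ∀ {γ : Vec ℕ n} → ZeroPrefix q γ → ZeroPrefix q (put q a γ)
zeroPrefix-put zero    = zero
zeroPrefix-put (suc z) = suc (zeroPrefix-put z)

-- Each use of `x*θ` turns one `θ` into `π` and raises the index of the lone variable by one, from p
-- to p+q. The zero prefix keeps x_{p+1}, ..., x_{p+q} out of the other monomial, which is therefore
-- invariant under every transposition involved.
x*cyc : ∀ p {γ : Vec ℕ n} → ZeroPrefix q γ → ∀ f →
        x p * (monomial (suc p) γ * cyc p q f) ≈ cycΠ p q (monomial p (put q 1 γ) * f)
x*cyc p {γ} zero f =
  solve 3 (λ a b c → a :* (b :* c) := ((a :* con (+ 1)) :* b) :* c) ≈-refl (x p) (monomial (suc p) γ) f
x*cyc {q = suc q} p {0 ∷ γ} (suc z) f = begin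
  x p * ((1# * M) * θ p C)
    ≈⟨ solve 3 (λ a b c → a :* ((con (+ 1) :* b) :* c) := b :* (a :* c)) ≈-refl (x p) M (θ p C) ⟩
  M * (x p * θ p C)
    ≈⟨ *-congˡ (x*θ p C) ⟩
  M * π p (x (suc p) * C)
    ≈⟨ π-*-invariant (s-monomial-below γ ℕ.≤-refl) _ ⟨
  π p (M * (x (suc p) * C))
    ≈⟨ π-cong p (solve 3 (λ a b c → a :* (b :* c) := b :* (a :* c)) ≈-refl M (x (suc p)) C) ⟩
  π p (x (suc p) * (M * C))
    ≈⟨ π-cong p (x*cyc (suc p) z f) ⟩
  π p (cycΠ (suc p) q (monomial (suc p) (put q 1 γ) * f))
    ≈⟨ cycΠ-cong p (suc q) (*-congʳ (*-identityˡ _)) ⟨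
  cycΠ p (suc q) ((1# * monomial (suc p) (put q 1 γ)) * f) ∎
  where
  M = monomial (2 ℕ.+ p) γ
  C = cyc (suc p) q f

-- The 0/1-vector marking the positions which the entries of β take in sort (β ++ δ).
marks : Vec ℕ k → Vec ℕ m → Vec ℕ (k ℕ.+ m)
marks []      δ = replicate _ 0
marks (b ∷ β) δ = put (above b (β ++ δ)) 1 (marks β δ)

-- No entry of `β` exceeds `b`, so the entries sorted in front of `b` all come from `δ` and are
-- unmarked.
zeroPrefix-marks : ∀ {β : Vec ℕ k} (δ : Vec ℕ m) → IsPartition (b ∷ β) →
                   ZeroPrefix (above b (β ++ δ)) (marks β δ)
zeroPrefix-marks δ [-] = zeroPrefix-replicate (above≤n _ δ)
zeroPrefix-marks {b = b} {c ∷ β} δ (b≥c ∷ P) rewrite above-no {a = b} (β ++ δ) b≥c =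
  zeroPrefix-≤ (above-antitone (β ++ δ) b≥c) (zeroPrefix-put (zeroPrefix-marks δ P))

-- Every entry of `β` uses up one variable of ω: `x p` commutes with the later operators and travels
-- along the first cycle. The sorted block `δ` contributes no cycles.
ω*Θ : ∀ p {β : Vec ℕ k} {δ : Vec ℕ m} → IsPartition β → IsPartition δ → ∀ f →
      ω p k * Θ p (code (β ++ δ)) f ≈ Π p (code (β ++ δ)) (monomial p (marks β δ) * f)
ω*Θ {m = m} p {[]} {δ} B D f
  rewrite Θ-code-partition p D f | Π-code-partition p D (monomial p (replicate m 0) * f) =
  *-congʳ (≈-sym (monomial-zeros p _))
ω*Θ {k = suc k} p {b ∷ β} {δ} B D f = begin
  (x p * ω (suc p) k) * Θ (suc p) C (cyc p q₀ f)            ≈⟨ *-assoc _ _ _ ⟩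
  x p * (ω (suc p) k * Θ (suc p) C (cyc p q₀ f))            ≈⟨ *-congˡ (ω*Θ (suc p) (Linked.tail B) D _) ⟩
  x p * Π (suc p) C (monomial (suc p) ε * cyc p q₀ f)       ≈⟨ Π-*-invariant (suc p) C s-below _ ⟨
  Π (suc p) C (x p * (monomial (suc p) ε * cyc p q₀ f))
    ≈⟨ Π-cong (suc p) C (x*cyc p (zeroPrefix-marks δ B) f) ⟩
  Π (suc p) C (cycΠ p q₀ (monomial p (put q₀ 1 ε) * f))      ∎
  where
  C = code (β ++ δ)
  q₀ = above b (β ++ δ)
  ε = marks β δ

put≤1 : ∀ q {γ : Vec ℕ n} → All (_≤ 1) γ → All (_≤ 1) (put q 1 γ)
put≤1 zero    A       = ℕ.≤-refl ∷ A
put≤1 (suc q) []      = ℕ.≤-refl ∷ []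
put≤1 (suc q) (a ∷ A) = a ∷ put≤1 q A

marks≤1 : ∀ (β : Vec ℕ k) (δ : Vec ℕ m) → All (_≤ 1) (marks β δ)
marks≤1 {m = m} [] δ = zeros≤1 m
  where
  zeros≤1 : ∀ m → All (_≤ 1) (replicate m 0)
  zeros≤1 zero    = []
  zeros≤1 (suc m) = z≤n ∷ zeros≤1 m
marks≤1 (b ∷ β) δ = put≤1 (above b (β ++ δ)) (marks≤1 β δ)

-- The new entry becomes b+1. The entries in front of it exceed `b` and are not raised, so they are
-- at least b+1; those behind are at most `b` and raised by at most 1.
partition-put : ∀ b {ε σ : Vec ℕ n} → ZeroPrefix (above b σ) ε → All (_≤ 1) ε →
                IsPartition σ → IsPartition (ε ⊕ σ) →
                IsPartition (put (above b σ) 1 ε ⊕ insert b σ)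
partition-put b {[]} {[]} z A S ES = [-]
partition-put b {e ∷ ε} {c ∷ σ} z (e≤1 ∷ A) S ES with b ℕ.<? c
... | no b≮c rewrite above-partition (ℕ.≮⇒≥ b≮c) S = ℕ.+-mono-≤ e≤1 (ℕ.≮⇒≥ b≮c) ∷ ES
partition-put b {0 ∷ []} {c ∷ []} z A S ES | yes b<c = b<c ∷ [-]
partition-put b {0 ∷ d ∷ ε} {c ∷ c′ ∷ σ} (suc z) (_ ∷ A) (c≥c′ ∷ S) (c≥ ∷ ES) | yes b<c
  with partition-put b z A S ES
... | R with b ℕ.<? c′
...   | yes _ = c≥ ∷ R
...   | no b≮c′ rewrite above-partition (ℕ.≮⇒≥ b≮c′) S = b<c ∷ R

partition-marks : ∀ {β : Vec ℕ k} {δ : Vec ℕ m} → IsPartition β →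
                  IsPartition (marks β δ ⊕ sort (β ++ δ))
partition-marks {β = []} {δ} B rewrite zeros-⊕ (sort δ) = sort-partition δ
partition-marks {β = b ∷ β} {δ} B
  with partition-put b {marks β δ} {sort (β ++ δ)}
-- `marks` counts in `β ++ δ`, `partition-put` in its sorted form; both give the same position.
... | P rewrite above-sort b (β ++ δ) =
  P (zeroPrefix-marks δ B) (marks≤1 β δ) (sort-partition (β ++ δ)) (partition-marks (Linked.tail B))

-- θ_y applied to the monomial of a partition

data EqualAt : ℕ → Vec ℕ n → Set where
  here  : {γ : Vec ℕ n} → EqualAt 0 (a ∷ a ∷ γ)
  there : {γ : Vec ℕ n} → EqualAt j γ → EqualAt (suc j) (a ∷ γ)

s-monomial : ∀ p {γ : Vec ℕ n} → EqualAt j γ → s (p ℕ.+ j) (monomial p γ) ≈ monomial p γ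
s-monomial p {a ∷ a ∷ γ} here rewrite ℕ.+-identityʳ p = begin
  s p (x p ^ a) * (s p (x (suc p) ^ a) * s p M)
    ≈⟨ *-cong (s-^-cong a (s-lower p)) (*-cong (s-^-cong a (s-upper p)) (s-monomial-below γ ℕ.≤-refl)) ⟩
  x (suc p) ^ a * (x p ^ a * M)
    ≈⟨ solve 3 (λ a b c → b :* (a :* c) := a :* (b :* c)) ≈-refl (x p ^ a) (x (suc p) ^ a) M ⟩
  x p ^ a * (x (suc p) ^ a * M) ∎
  where
  M = monomial (2 ℕ.+ p) γ
  s-^-cong : ∀ {i g h} a → s i g ≈ h → s i (g ^ a) ≈ h ^ a
  s-^-cong zero    e = ≈-refl
  s-^-cong (suc a) e = *-cong e (s-^-cong a e)
s-monomial {j = suc j} p {a ∷ γ} (there E) rewrite ℕ.+-suc p j =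
  *-cong (s-^ a (s-below (s≤s (ℕ.m≤m+n p j)))) (s-monomial (suc p) E)

-- Equal entries both exceed `a` or both do not, so insertion cannot separate them; the pair stays
-- in place or moves by one.
equalAt-insert : ∀ a {σ : Vec ℕ n} → IsPartition σ → EqualAt j σ →
                 (suc j < above a σ × EqualAt j (insert a σ))
                 ⊎ (above a σ ≤ j × EqualAt (suc j) (insert a σ))
equalAt-insert a {b ∷ _ ∷ σ} S here with a ℕ.<? b in a<?b
... | yes _ rewrite a<?b = inj₁ (s≤s (s≤s z≤n) , here)
... | no a≮b rewrite a<?b | above-partition {γ = σ} (ℕ.≮⇒≥ a≮b) (Linked.tail S) =
  inj₂ (z≤n , there here)
equalAt-insert a {b ∷ σ} S (there E) with a ℕ.<? b
... | no a≮b rewrite above-partition (ℕ.≮⇒≥ a≮b) S = inj₂ (z≤n , there (there E))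
... | yes _ with equalAt-insert a (Linked.tail S) E
...   | inj₁ (j< , E′) = inj₁ (s≤s j< , there E′)
...   | inj₂ (≤j , E′) = inj₂ (s≤s ≤j , there E′)

Extract : ℕ → Vec ℕ (suc n) → Set
Extract {n} q λ′ = Σ[ a ∈ ℕ ] Σ[ σ ∈ Vec ℕ n ] insert a σ ≡ λ′ × above a σ ≡ q × IsPartition σ

-- Taking out the entry at position q fails only if it equals its left neighbour: `insert` would put
-- it back in front of that neighbour.
extract : ∀ {σ : Vec ℕ (suc n)} → IsPartition σ → q ≤ n →
          Extract q σ ⊎ Σ[ r ∈ ℕ ] (q ≡ suc r × EqualAt r σ)
extract {σ = a ∷ σ} S z≤n =
  inj₁ (a , σ , insert-head S , above-partition {γ = σ} ℕ.≤-refl S , Linked.tail S)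
extract {q = suc zero} {σ = b ∷ c ∷ σ} (b≥c ∷ S) (s≤s z≤n) with ℕ.m≤n⇒m<n∨m≡n b≥c
... | inj₂ ≡.refl = inj₂ (0 , ≡.refl , here)
... | inj₁ c<b    = inj₁ (c , b ∷ σ , ins , trans-above , tail S)
  where
  ins : insert c (b ∷ σ) ≡ b ∷ c ∷ σ
  ins with c ℕ.<? b
  ... | yes _   = cong (b ∷_) (insert-head S)
  ... | no  c≮b = contradiction c<b c≮b
  trans-above : above c (b ∷ σ) ≡ 1
  trans-above = ≡.trans (above-yes σ c<b) (cong suc (above-partition {γ = σ} ℕ.≤-refl S))
  tail : ∀ {σ : Vec ℕ n} → IsPartition (c ∷ σ) → IsPartition (b ∷ σ)
  tail [-]        = [-]
  tail (c≥d ∷ S) = ℕ.≤-trans c≥d b≥c ∷ S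
-- In the tail the position `suc q` is positive, so the extracted entry lies strictly below the head
-- of what remains, and hence below `b`.
extract {q = suc (suc q)} {σ = b ∷ σ} S (s≤s q≤n) with extract (Linked.tail S) q≤n
... | inj₂ (r , e , E) = inj₂ (suc r , cong suc e , there E)
... | inj₁ (a , c ∷ σ′ , e , e′ , S′) with a ℕ.<? c
...   | no a≮c = contradiction (≡.trans (≡.sym (above-partition (ℕ.≮⇒≥ a≮c) S′)) e′) λ ()
extract {q = suc (suc q)} {σ = b ∷ σ} (b≥c ∷ S) (s≤s q≤n) | inj₁ (a , c ∷ σ′ , ≡.refl , e′ , S′) | yes a<c =
  inj₁ (a , b ∷ c ∷ σ′ , ins , trans-above , b≥c ∷ S′)
  where
  a<b = ℕ.<-≤-trans a<c b≥c
  ins : insert a (b ∷ c ∷ σ′) ≡ b ∷ c ∷ insert a σ′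
  ins with a ℕ.<? b
  ... | no  a≮b = contradiction a<b a≮b
  ... | yes _ with a ℕ.<? c
  ...   | yes _   = ≡.refl
  ...   | no  a≮c = contradiction a<c a≮c
  trans-above : above a (b ∷ c ∷ σ′) ≡ suc (suc q)
  trans-above = ≡.trans (above-yes (c ∷ σ′) a<b) (cong suc (≡.trans (above-yes σ′ a<c) e′))

-- The property of x^σ that survives the recursion of `decode`, where f is replaced by its images
-- under cycles, which need not be monomials.
Killed : ℕ → Vec ℕ n → P → Set
Killed p σ f = ∀ {j} → EqualAt j σ → θ (p ℕ.+ j) f ≈ 0#

-- Moved to the other side of the cycle, `θ` acquires exactly the index of the same equal pair in
-- `insert a σ`, where it kills `f`.
killed-cyc : ∀ p a {σ : Vec ℕ n} → IsPartition σ → Killed p (insert a σ) f →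
             Killed (suc p) σ (cyc p (above a σ) f)
killed-cyc {f = f} p a {σ} S K {j} E with equalAt-insert a S E
... | inj₁ (j< , E′) = begin
  θ (suc (p ℕ.+ j)) (cyc p q₀ f)
    ≈⟨ cyc-θ-inside p q₀ (ℕ.m≤m+n p j) 
         (≡.subst (_≤ p ℕ.+ q₀) (≡.trans (ℕ.+-suc p (suc j)) (cong suc (ℕ.+-suc p j)))
                  (ℕ.+-monoʳ-≤ p j<)) f ⟨
  cyc p q₀ (θ (p ℕ.+ j) f)        ≈⟨ cyc-cong p q₀ (K E′) ⟩
  cyc p q₀ 0#                     ≈⟨ cyc-0 p q₀ ⟩
  0#                             ∎
  where q₀ = above a σ
... | inj₂ (≤j , E′) = begin
  θ (suc (p ℕ.+ j)) (cyc p q₀ f)  ≈⟨ cyc-θ-above p q₀ (s≤s (ℕ.+-monoʳ-≤ p ≤j)) f ⟨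
  cyc p q₀ (θ (suc (p ℕ.+ j)) f)
    ≈⟨ cyc-cong p q₀ (≡.subst (λ i → θ i f ≈ 0#) (ℕ.+-suc p j) (K E′)) ⟩
  cyc p q₀ 0#                     ≈⟨ cyc-0 p q₀ ⟩
  0#                             ∎
  where q₀ = above a σ

-- The first code entry names the position in `σ` of the first entry of γ. If that entry equals its
-- left neighbour, at position r, then the innermost factor of the first cycle is θ_{p+r}, which
-- kills `f`.
decode : ∀ {c σ : Vec ℕ n} → IsCode c → IsPartition σ →
         (Σ[ γ ∈ Vec ℕ n ] code γ ≡ c × sort γ ≡ σ)
         ⊎ (∀ p {f} → Killed p σ f → Θ p c f ≈ 0#)
decode {c = []} {[]} [] [] = inj₁ ([] , ≡.refl , ≡.refl)
decode {suc n} {c = q ∷ c} (q≤n ∷ isC) S with extract S q≤n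
... | inj₂ (r , ≡.refl , E) = inj₂ λ p {f} K →
  ≈-trans (Θ-cong (suc p) c (≈-trans (cyc-snoc p r f) (≈-trans (cyc-cong p r (K E)) (cyc-0 p r))))
          (Θ-0 (suc p) c)
... | inj₁ (a , σ′ , ≡.refl , ≡.refl , S′) with decode isC S′
...   | inj₁ (γ , ≡.refl , ≡.refl) = inj₁ (a ∷ γ , cong (_∷ code γ) (≡.sym (above-sort a γ)) , ≡.refl)
...   | inj₂ vanishes = inj₂ λ p K → vanishes (suc p) (killed-cyc p a S′ K)

-- Sums of atoms, and multiplication by x^μ

Σ𝒜 : List (Vec ℕ n) → P
Σ𝒜 = foldr (λ β f → 𝒜 β + f) 0#

Positive : ℕ → P → Set
Positive n f = Σ[ L ∈ List (Vec ℕ n) ] f ≈ Σ𝒜 L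

positive-cone : ∀ {F} {σ : Vec ℕ n} → IsPartition σ → Cone n F → Positive n (F (x^ σ))
positive-cone S (zero e) = [] , e _
positive-cone {σ = σ} S (add c isC C e) with positive-cone S C | decode isC S
... | L , e′ | inj₁ (γ , ≡.refl , ≡.refl) =
  γ ∷ L , ≈-trans (e _) (+-cong (reflexive (≡.sym (𝒜≡Θ γ))) e′)
... | L , e′ | inj₂ vanishes =
  L , ≈-trans (e _) (≈-trans (+-cong (vanishes 0 λ E → θ-invariant (s-monomial 0 E)) e′)
                             (+-identityˡ _))

Σ𝒜-++ : (K L : List (Vec ℕ n)) → Σ𝒜 K + Σ𝒜 L ≈ Σ𝒜 (K List.++ L)
Σ𝒜-++ []      L = +-identityˡ _
Σ𝒜-++ (β ∷ K) L = ≈-trans (+-assoc _ _ _) (+-congˡ (Σ𝒜-++ K L))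

positive-+ : Positive n f → Positive n g → Positive n (f + g)
positive-+ (K , e) (L , e′) = K List.++ L , ≈-trans (+-cong e e′) (Σ𝒜-++ K L)

positive-resp : f ≈ g → Positive n g → Positive n f
positive-resp e (L , e′) = L , ≈-trans e e′

ω*𝒜 : ∀ k (γ : Vec ℕ (k ℕ.+ m)) → Positive (k ℕ.+ m) (ω 0 k * 𝒜 γ)
ω*𝒜 k γ with Vec.splitAt k γ
... | β , δ , ≡.refl = positive-resp (begin
    ω 0 k * 𝒜 (β ++ δ)
      ≈⟨ *-congˡ (reflexive (𝒜≡Θ (β ++ δ))) ⟩
    ω 0 k * Θ 0 (code (β ++ δ)) (x^ sort (β ++ δ))
      ≈⟨ *-congˡ (Θ-code-blocks 0 β δ _) ⟩
    ω 0 k * Θ 0 U (Θ 0 (code (β′ ++ δ′)) (x^ sort (β ++ δ)))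
      ≈⟨ Θ-ω 0 (code δ) (isCode β) _ ⟨
    Θ 0 U (ω 0 k * Θ 0 (code (β′ ++ δ′)) (x^ sort (β ++ δ)))
      ≈⟨ Θ-cong 0 U (ω*Θ 0 (sort-partition β) (sort-partition δ) _) ⟩
    Θ 0 U (Π 0 (code (β′ ++ δ′)) (x^ ε * x^ sort (β ++ δ)))
      ≈⟨ Θ-cong 0 U (Π-cong 0 (code (β′ ++ δ′)) (monomial-⊕ 0 ε _)) ⟩
    Θ 0 U (Π 0 (code (β′ ++ δ′)) (x^ (ε ⊕ sort (β ++ δ)))) ∎)
  (positive-cone
    -- The marks belong to the sorted blocks, whose common shape is that of the original
    -- composition.
    (≡.subst (λ σ → IsPartition (ε ⊕ σ)) (sort-blocks β δ) (partition-marks {δ = δ′} (sort-partition β)))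
    (Cone-Π 0 (isCode (β′ ++ δ′)) ≡.refl (Cone-Θ (isCode-++ (isCode β) (isCode δ)))))
  where
  β′ = sort β
  δ′ = sort δ
  ε  = marks β′ δ′
  U  = code β ++ code δ

positive-ω : k ≤ n → Positive n f → Positive n (ω 0 k * f)
positive-ω {k} {n} k≤n (L , e) = positive-resp (*-congˡ e) (go L)
  where
  go : ∀ L → Positive n (ω 0 k * Σ𝒜 L)
  go []      = [] , zeroʳ _
  go (β ∷ L) with ℕ.m≤n⇒∃[o]m+o≡n k≤n
  ... | m , ≡.refl = positive-resp (*-distribˡ _ _ _) (positive-+ (ω*𝒜 k β) (go L))

positive-ω^ : ∀ a → k ≤ n → Positive n f → Positive n (ω 0 k ^ a * f)
positive-ω^ zero    k≤n Q = positive-resp (*-identityˡ _) Q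
positive-ω^ (suc a) k≤n Q = positive-resp (*-assoc _ _ _) (positive-ω k≤n (positive-ω^ a k≤n Q))

headOr0 : Vec ℕ n → ℕ
headOr0 []      = 0
headOr0 (a ∷ γ) = a

headOr0-≤ : {μ : Vec ℕ n} → IsPartition (a ∷ μ) → headOr0 μ ≤ a
headOr0-≤ [-] = z≤n
headOr0-≤ {μ = _ ∷ _} (a≥b ∷ _) = a≥b

-- Induction on μ works once the leading variables x₁ ⋯ xₖ are raised to the power μ₁.
positive-monomial : ∀ k {μ : Vec ℕ m} → k ℕ.+ m ≡ n → IsPartition μ → Positive n f →
                    Positive n ((ω 0 k ^ headOr0 μ * monomial k μ) * f)
positive-monomial k {[]} e M Q =
  positive-resp (≈-trans (*-congʳ (*-identityʳ _)) (*-identityˡ _)) Q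
positive-monomial {suc m} {n} {f} k {a ∷ μ} e M Q = positive-resp (begin
    (ω 0 k ^ a * (x k ^ a * N)) * f
      ≈⟨ *-congʳ (≈-sym (*-assoc _ _ _)) ⟩
    ((ω 0 k ^ a * x k ^ a) * N) * f
      ≈⟨ *-congʳ (*-congʳ (≈-sym (^-distrib-* (ω 0 k) (x k) a))) ⟩
    ((ω 0 k * x k) ^ a * N) * f
      ≈⟨ *-congʳ (*-congʳ (^-congˡ a (≈-sym (ω-snoc 0 k)))) ⟩
    (ω 0 (suc k) ^ a * N) * f
      ≈⟨ *-congʳ (*-congʳ (reflexive (cong (ω 0 (suc k) ^_) (≡.sym (ℕ.m∸n+n≡m (headOr0-≤ M)))))) ⟩
    (ω 0 (suc k) ^ (a ℕ.∸ b₀ ℕ.+ b₀) * N) * f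
      ≈⟨ *-congʳ (*-congʳ (^-homo-* (ω 0 (suc k)) (a ℕ.∸ b₀) b₀)) ⟩
    ((ω 0 (suc k) ^ (a ℕ.∸ b₀) * ω 0 (suc k) ^ b₀) * N) * f
      ≈⟨ solve 4 (λ a b c d → ((a :* b) :* c) :* d := a :* ((b :* c) :* d)) ≈-refl _ _ N f ⟩
    ω 0 (suc k) ^ (a ℕ.∸ b₀) * ((ω 0 (suc k) ^ b₀ * N) * f) ∎)
  (positive-ω^ (a ℕ.∸ b₀) (ℕ.m+n≤o⇒m≤o (suc k) (ℕ.≤-reflexive e′))
    (positive-monomial (suc k) e′ (Linked.tail M) Q))
  where
  b₀ = headOr0 μ
  N = monomial (suc k) μ
  e′ : suc k ℕ.+ m ≡ n
  e′ = ≡.trans (≡.sym (ℕ.+-suc k m)) e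

1^a≈1 : ∀ a → 1# ^ a ≈ 1#
1^a≈1 zero    = ≈-refl
1^a≈1 (suc a) = ≈-trans (*-identityˡ _) (1^a≈1 a)

𝒜-partition : {μ : Vec ℕ n} → IsPartition μ → 𝒜 μ ≡ x^ μ
𝒜-partition {μ = μ} M =
  ≡.trans (𝒜≡Θ μ) (≡.trans (Θ-code-partition 0 M _) (cong x^_ (sort-fixes-partition M)))

positive⇒atomPositive : Positive n f → AtomPositive f
positive⇒atomPositive {n} (L , e) = List.map (λ β → 1 , n , β) L , ≈-trans e (sum L)
  where
  sum : ∀ L → Σ𝒜 L ≈ Σ-𝒜 (List.map (λ β → 1 , n , β) L)
  sum []      = ≈-refl
  sum (β ∷ L) = +-cong (≈-sym (*-identityˡ _)) (sum L)

theorem4p1 : (n : ℕ) → 1 ≤ n → (μ α : Vec ℕ n) → IsPartition μ → AtomPositive (𝒜 μ * 𝒜 α)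
theorem4p1 n _ μ α M = positive⇒atomPositive (positive-resp (begin
    𝒜 μ * 𝒜 α                        ≈⟨ *-congʳ (reflexive (𝒜-partition M)) ⟩
    x^ μ * 𝒜 α                        ≈⟨ *-congʳ (*-identityˡ _) ⟨
    -- The induction starts with no leading variables, where the power of ω is a power of `ω 0 0`,
    -- that is, of 1.
    (1# * x^ μ) * 𝒜 α                 ≈⟨ *-congʳ (*-congʳ (1^a≈1 (headOr0 μ))) ⟨
    (1# ^ headOr0 μ * x^ μ) * 𝒜 α     ∎)
  (positive-monomial 0 ≡.refl M (α ∷ [] , ≈-sym (+-identityʳ _))))
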